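{- Let $t$ be a positive integer and $n$ an integer with $2<n<\frac{15+\sqrt{33}}{24}t^2$. Let $M$ be an $n\times(n-1)$ $t$-disjunct matrix. Then the rows of $M$ can be permuted so that the first $n-1$ rows form a permutation matrix of degree $n-1$ (the last row being arbitrary).
   Context: A binary $n\times w$ matrix is $t$-disjunct if its columns are distinct and for every $j\le t$ the Boolean sum of any $j$ columns does not contain any other column (equivalently, it is the incidence matrix of a $t$-cover-free family). A permutation matrix of degree $k$ is a $k\times k$ $0/1$ matrix with exactly one $1$ in each row and column. -}

module Defs where

open import Data.Nat using (ℕ; suc; _+_; _*_; _∸_; _^_; _≤_; _<_)
open import Data.Bool using (Bool; true; false)
open import Data.Fin using (Fin; inject₁)
open import Data.Fin.Subset using (Subset; _∈_; _∉_; ∣_∣)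
open import Data.Fin.Permutation using (Permutation′; _⟨$⟩ʳ_)
open import Data.Product using (Σ; ∃; _×_; _,_)
open import Data.Sum using (_⊎_)
open import Relation.Binary.PropositionalEquality using (_≡_)

BinMatrix : ℕ → ℕ → Set
BinMatrix r c = Fin r → Fin c → Bool

DistinctColumns : ∀ {r c} → BinMatrix r c → Set
DistinctColumns {r} {c} M = (j k : Fin c) → (∀ (i : Fin r) → M i j ≡ M i k) → j ≡ k

SumNotContains : ∀ {r c} → BinMatrix r c → Subset c → Fin c → Set
SumNotContains {r} M S k = Σ (Fin r) λ i → (M i k ≡ true) × (∀ j → j ∈ S → M i j ≡ false)

Disjunct : ∀ {r c} → ℕ → BinMatrix r c → Set
Disjunct {r} {c} t M =
  DistinctColumns M ×
  ((S : Subset c) → 1 ≤ ∣ S ∣ → ∣ S ∣ ≤ t → (k : Fin c) → k ∉ S → SumNotContains M S k)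

ExactlyOneTrue : ∀ {k} → (Fin k → Bool) → Set
ExactlyOneTrue {k} v = Σ (Fin k) λ j → (v j ≡ true) × (∀ j′ → v j′ ≡ true → j′ ≡ j)

IsPermutationMatrix : ∀ {k} → BinMatrix k k → Set
IsPermutationMatrix {k} P =
  (∀ i → ExactlyOneTrue (λ j → P i j)) × (∀ j → ExactlyOneTrue (λ i → P i j))

-- n < ((15 + √33)/24) t², i.e. 24 n − 15 t² < √33 t², stated over ℕ:
-- either 24 n < 15 t², or 15 t² ≤ 24 n and (24 n − 15 t²)² < 33 t⁴.
-- (Exact since √33 is irrational / both sides are nonnegative.)
BelowBound : ℕ → ℕ → Set
BelowBound t n =
  (24 * n < 15 * t ^ 2) ⊎
  ((15 * t ^ 2 ≤ 24 * n) × ((24 * n ∸ 15 * t ^ 2) ^ 2 < 33 * t ^ 4))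

{-# OPTIONS --safe #-}

-- The conclusion says that every column has a private row, i.e. a row meeting no other column.
-- Deleting a column together with one of its private rows preserves everything, so the point is to
-- find one private row.  If there is none, call a pair of rows of a column k own if no other column
-- contains it.  A matching in the graph of non-own pairs of k yields a cover of k by other columns,
-- one for each matching edge and one for each unmatched row, so this graph has a small matching
-- number, and an Erdős–Gallai bound yields many own pairs.  Two cases (n rows, v = size of k):
-- * v t ≥ 2n for some k: deleting k and its rows leaves a (t−1)-disjunct matrix with far more
--   columns than rows and with n − v below the bound for t − 1; induct on t.
-- * v t < 2n for all k: each column has more than n/2 own pairs, which are distinct for distinct
--   columns, so (n−1)(n+1) ≤ n(n−1), a contradiction.  The constant (15 + √33)/24 is exactly where
--   the two cases meet.
module Submission where

open import Defs
open import Data.Nat hiding (_≟_)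
open import Data.Nat.Properties hiding (_≟_)
open import Data.Nat.ListAction using (sum)
open import Data.Nat.ListAction.Properties using (sum-++; sum-↭)
open import Data.Nat.Tactic.RingSolver using (solve-∀)
open import Data.Bool using (Bool; true; false) renaming (_≟_ to _≟ᵇ_)
open import Data.Fin using (Fin; zero; suc; inject₁; punchOut; punchIn)
open import Data.Fin.Properties using (_≟_; punchIn-punchOut; punchOut-injective)
open import Data.Fin.Permutation as Perm using (Permutation′; _⟨$⟩ʳ_; insert; insert-punchIn)
open import Data.Fin.Subset using (Subset; ∣_∣; _∪_; ⁅_⁆) renaming (_∈_ to _∈ˢ_; ⊥ to ∅)
open import Data.Fin.Subset.Properties using (x∈p∪q⁺; x∈p∪q⁻; x∈⁅x⁆; x∈⁅y⁆⇒x≡y; ∣⁅x⁆∣≡1; ∣p∣≤∣p∪q∣; ∉⊥; ∣⊥∣≡0)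
open import Data.Vec using ([]; _∷_)
open import Data.List using (List; []; _∷_; _++_; map; length; filter; foldr; allFin)
open import Data.List.Properties using (map-++; map-cong; ++-assoc; length-++; length-map; length-filter; length-tabulate)
open import Data.List.Membership.Propositional using (_∈_; _∉_; find; lose)
open import Data.List.Membership.Propositional.Properties using (∈-∃++; ∈-++⁻; ∈-++⁺ʳ; ∈-map⁻; ∈-filter⁺; ∈-filter⁻; ∈-allFin)
open import Data.List.Relation.Unary.All as All using (All; []; _∷_; all?)
import Data.List.Relation.Unary.All.Properties as All
open import Data.List.Relation.Unary.Any as Any using (Any; here; there; any?)
import Data.List.Relation.Unary.Any.Properties as Any
open import Data.List.Relation.Unary.AllPairs using ([]; _∷_)
open import Data.List.Relation.Unary.Unique.Propositional using (Unique)
import Data.List.Relation.Unary.Unique.Propositional.Properties as Unique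
open import Data.List.Relation.Binary.Permutation.Propositional using (_↭_; ↭-refl; ↭-sym; ↭-trans; ↭-reflexive; prep; swap; ↭⇒↭ₛ)
open import Data.List.Relation.Binary.Permutation.Propositional.Properties using (shift; ++⁺; ++⁺ˡ; ++⁺ʳ; ∈-resp-↭; All-resp-↭; Any-resp-↭; ↭-length; map⁺; ++-commutativeMonoid)
import Data.List.Relation.Binary.Permutation.Setoid.Properties as Permₛ
import Algebra.Solver.CommutativeMonoid as CMSolver
open import Data.Product using (Σ; ∃; ∃₂; _×_; _,_; proj₁; proj₂)
open import Data.Sum using (_⊎_; inj₁; inj₂)
open import Data.Empty using (⊥; ⊥-elim)
open import Function using (_∘_; case_of_; id)
open import Function.Definitions using (Injective)
open import Relation.Nullary using (Dec; ¬_; yes; no; ¬?; contradiction)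
open import Relation.Nullary.Decidable using (_×-dec_; _→-dec_; decidable-stable)
open import Relation.Unary using (Decidable)
open import Relation.Binary using (DecidableEquality)
open import Relation.Binary.PropositionalEquality using (_≡_; _≢_; refl; sym; trans; cong; cong₂; subst; subst₂; setoid; ≢-sym)

-- The bound

-- n < cT for c = (15 + √33)/24, the larger root of 12x² − 15x + 4.
data Below (T n : ℕ) : Set where
  linear    : 24 * n < 15 * T → Below T n
  quadratic : 12 * (n * n) + 4 * (T * T) < 15 * (n * T) → Below T n

-- Completing the square: 48 (12n² - 15nT + 4T²) = (24n - 15T)² - 33T². The truncated subtraction in
-- `D` is exact because this case assumes 15T ≤ 24n.
belowBound⇒below : ∀ t n → BelowBound t n → Below (t * t) n
belowBound⇒below t n (inj₁ p) = linear (subst (24 * n <_) (cong (λ u → 15 * (t * u)) (*-identityʳ t)) p)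
belowBound⇒below t n (inj₂ (p , q)) = quadratic (*-cancelˡ-< 48 _ _ (begin-strict
  48 * (12 * (n * n) + 4 * (T * T))    ≡⟨ e₁ n T ⟩
  (24 * n) * (24 * n) + 192 * (T * T)  ≡⟨ cong (λ u → u * u + 192 * (T * T)) x≡ ⟩
  (D + 15 * T) * (D + 15 * T) + 192 * (T * T) ≡⟨ e₂ D T ⟩
  D ^ 2 + (30 * (D * T) + 417 * (T * T)) <⟨ +-monoˡ-< _ q ⟩
  33 * t ^ 4 + (30 * (D * T) + 417 * (T * T)) ≡⟨ e₃ t D ⟩
  30 * ((D + 15 * T) * T) ≡⟨ cong (λ u → 30 * (u * T)) (sym x≡) ⟩
  30 * ((24 * n) * T) ≡⟨ e₄ n T ⟩
  48 * (15 * (n * T)) ∎))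
  where
  open ≤-Reasoning
  T D : ℕ
  T = t * t
  D = 24 * n ∸ 15 * t ^ 2
  x≡ : 24 * n ≡ D + 15 * T
  x≡ = trans (sym (m∸n+n≡m p)) (cong (λ u → D + 15 * (t * u)) (*-identityʳ t))
  e₁ : ∀ n T → 48 * (12 * (n * n) + 4 * (T * T)) ≡ (24 * n) * (24 * n) + 192 * (T * T)
  e₁ = solve-∀
  e₂ : ∀ D T → (D + 15 * T) * (D + 15 * T) + 192 * (T * T) ≡
    D * (D * 1) + (30 * (D * T) + 417 * (T * T))
  e₂ = solve-∀
  e₃ : ∀ t D → 33 * (t * (t * (t * (t * 1)))) + (30 * (D * (t * t)) + 417 * ((t * t) * (t * t))) ≡
    30 * ((D + 15 * (t * t)) * (t * t))
  e₃ = solve-∀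
  e₄ : ∀ n T → 30 * ((24 * n) * T) ≡ 48 * (15 * (n * T))
  e₄ = solve-∀

-- The constant c is below 1. In the quadratic case, n = T + e with e ≥ 0 would turn 12n² - 15nT +
-- 4T² into T² + 9eT + 12e², which is not negative.
below⇒< : ∀ {T n} → Below T n → n < T
below⇒< {T} {n} (linear p) = *-cancelˡ-< 15 n T (≤-<-trans (*-monoˡ-≤ n (m≤n+m 15 9)) p)
below⇒< {T} {n} (quadratic p) with n <? T
... | yes q = q
... | no q  = contradiction p (≤⇒≯ (begin
  15 * (n * T)                                 ≡⟨ cong (λ u → 15 * (u * T)) n≡ ⟩
  15 * ((T + e) * T)                           ≤⟨ m≤m+n _ _ ⟩
  15 * ((T + e) * T) + (T * T + 9 * (e * T) + 12 * (e * e)) ≡⟨ e₁ T e ⟩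
  12 * ((T + e) * (T + e)) + 4 * (T * T)       ≡⟨ cong (λ u → 12 * (u * u) + 4 * (T * T)) (sym n≡) ⟩
  12 * (n * n) + 4 * (T * T)                   ∎))
  where
  open ≤-Reasoning
  e : ℕ
  e = n ∸ T
  n≡ : n ≡ T + e
  n≡ = sym (m+[n∸m]≡n (≮⇒≥ q))
  e₁ : ∀ T e → 15 * ((T + e) * T) + (T * T + 9 * (e * T) + 12 * (e * e)) ≡
    12 * ((T + e) * (T + e)) + 4 * (T * T)
  e₁ = solve-∀

-- The bound depends only on the ratio n/T and passes to smaller ratios; the ratios are compared by
-- cross-multiplication.
below-scale : ∀ {T T′ n n′} → 0 < T → 0 < T′ → n′ * T ≤ n * T′ → Below T n → Below T′ n′
below-scale {suc T-1} {suc T′-1} {n} {n′} _ _ le (linear p) =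
  linear (*-cancelʳ-< (suc T-1) _ _ (begin-strict
  24 * n′ * T     ≡⟨ *-assoc 24 n′ T ⟩
  24 * (n′ * T)   ≤⟨ *-monoʳ-≤ 24 le ⟩
  24 * (n * T′)   ≡⟨ *-assoc 24 n T′ ⟨
  24 * n * T′     <⟨ *-monoˡ-< T′ p ⟩
  15 * T * T′     ≡⟨ e₁ T T′ ⟩
  15 * T′ * T     ∎))
  where
  open ≤-Reasoning
  T T′ : ℕ
  T = suc T-1
  T′ = suc T′-1
  e₁ : ∀ T T′ → 15 * T * T′ ≡ 15 * T′ * T
  e₁ = solve-∀
below-scale {suc T-1} {suc T′-1} {n} {n′} _ _ le (quadratic p) with 24 * n′ <? 15 * suc T′-1
... | yes q = linear q
-- Over the common denominator D = T′T the ratios are a/D and (a + e)/D. Both lie at or beyond the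
-- vertex 15/24 of 12x² - 15x + 4, where the parabola increases, so its value at a/D is negative
-- too.
... | no  q = quadratic (*-cancelʳ-< (T * T) _ _ (subst₂ _<_ (e₁ n′ T T′) (e₂ n′ T T′)
    (+-cancelʳ-< (24 * (a * e)) _ _ (begin-strict
      12 * (a * a) + 4 * (D * D) + 24 * (a * e)  ≤⟨ m≤m+n _ (12 * (e * e)) ⟩
      12 * (a * a) + 4 * (D * D) + 24 * (a * e) + 12 * (e * e) ≡⟨ e₃ a e D ⟩
      12 * ((a + e) * (a + e)) + 4 * (D * D) ≡⟨ cong (λ u → 12 * (u * u) + 4 * (D * D)) a+e≡ ⟩
      12 * ((n * T′) * (n * T′)) + 4 * (D * D) ≡⟨ e₄ n T T′ ⟩
      (12 * (n * n) + 4 * (T * T)) * (T′ * T′)  <⟨ *-monoˡ-< (T′ * T′) p ⟩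
      15 * (n * T) * (T′ * T′)               ≡⟨ e₅ n T T′ ⟩
      15 * ((n * T′) * D)                    ≡⟨ cong (λ u → 15 * (u * D)) (sym a+e≡) ⟩
      15 * ((a + e) * D)                     ≡⟨ e₆ a e D ⟩
      15 * (a * D) + 15 * D * e              ≤⟨ +-monoʳ-≤ (15 * (a * D)) (*-monoˡ-≤ e 15D≤24a) ⟩
      15 * (a * D) + 24 * a * e              ≡⟨ cong (15 * (a * D) +_) (*-assoc 24 a e) ⟩
      15 * (a * D) + 24 * (a * e) ∎))))
  where
  open ≤-Reasoning
  T T′ a e D : ℕ
  T = suc T-1
  T′ = suc T′-1
  a = n′ * T
  e = n * T′ ∸ n′ * T
  D = T′ * T
  a+e≡ : a + e ≡ n * T′
  a+e≡ = m+[n∸m]≡n le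
  15D≤24a : 15 * D ≤ 24 * a
  15D≤24a = subst₂ _≤_ (*-assoc 15 T′ T) (*-assoc 24 n′ T) (*-monoˡ-≤ T (≮⇒≥ q))
  e₁ : ∀ n′ T T′ → 12 * (n′ * T * (n′ * T)) + 4 * (T′ * T * (T′ * T)) ≡
    (12 * (n′ * n′) + 4 * (T′ * T′)) * (T * T)
  e₁ = solve-∀
  e₂ : ∀ n′ T T′ → 15 * (n′ * T * (T′ * T)) ≡ 15 * (n′ * T′) * (T * T)
  e₂ = solve-∀
  e₃ : ∀ a e D → 12 * (a * a) + 4 * (D * D) + 24 * (a * e) + 12 * (e * e) ≡
    12 * ((a + e) * (a + e)) + 4 * (D * D)
  e₃ = solve-∀
  e₄ : ∀ n T T′ → 12 * ((n * T′) * (n * T′)) + 4 * (T′ * T * (T′ * T)) ≡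
    (12 * (n * n) + 4 * (T * T)) * (T′ * T′)
  e₄ = solve-∀
  e₅ : ∀ n T T′ → 15 * (n * T) * (T′ * T′) ≡ 15 * ((n * T′) * (T′ * T))
  e₅ = solve-∀
  e₆ : ∀ a e D → 15 * ((a + e) * D) ≡ 15 * (a * D) + 15 * D * e
  e₆ = solve-∀

rearrangement : ∀ {a b c d} → a ≤ b → c ≤ d → a * d + b * c ≤ b * d + a * c
rearrangement {a} {b} {c} {d} a≤b c≤d = begin
  a * d + b * c
    ≡⟨ cong₂ (λ u v → a * u + v * c) (m+[n∸m]≡n c≤d) (m+[n∸m]≡n a≤b) ⟨
  a * (c + (d ∸ c)) + (a + (b ∸ a)) * c
    ≤⟨ m≤m+n _ ((b ∸ a) * (d ∸ c)) ⟩
  a * (c + (d ∸ c)) + (a + (b ∸ a)) * c + (b ∸ a) * (d ∸ c)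
    ≡⟨ e a (b ∸ a) c (d ∸ c) ⟩
  (a + (b ∸ a)) * (c + (d ∸ c)) + a * c
    ≡⟨ cong₂ (λ u v → v * u + a * c) (m+[n∸m]≡n c≤d) (m+[n∸m]≡n a≤b) ⟩
  b * d + a * c ∎
  where
  open ≤-Reasoning
  e : ∀ a x c y → a * (c + y) + (a + x) * c + x * y ≡ (a + x) * (c + y) + a * c
  e = solve-∀

-- The smaller root (15 - √33)/24 lies below 1/2, so the quadratic is negative for all ratios from
-- 1/2 to 15/24. In the linear case this follows from (15T - 24n)(2n - T) ≥ 0 and 2T² < 12nT.
below⇒quadratic : ∀ {T n} → T ≤ 2 * n → 0 < T → Below T n → 12 * (n * n) + 4 * (T * T) < 15 * (n * T)
below⇒quadratic _ _ (quadratic p) = p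
below⇒quadratic {T} {n} T≤2n 0<T (linear p) =
  *-cancelˡ-< 8 _ _ (+-cancelʳ-< (108 * (n * T)) _ _ (begin-strict
  8 * (12 * (n * n) + 4 * (T * T)) + 108 * (n * T)
    ≡⟨ e₁ n T ⟩
  2 * (24 * n * (2 * n) + 15 * T * T) + (2 * (T * T) + 108 * (n * T))
    ≤⟨ +-monoˡ-≤ _ (*-monoʳ-≤ 2 (rearrangement (<⇒≤ p) T≤2n)) ⟩
  2 * (15 * T * (2 * n) + 24 * n * T) + (2 * (T * T) + 108 * (n * T))
    ≡⟨ e₂ n T ⟩
  216 * (n * T) + 2 * (T * T)
    <⟨ +-monoʳ-< (216 * (n * T)) lt ⟩
  216 * (n * T) + 12 * (n * T)
    ≡⟨ e₃ n T ⟩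
  8 * (15 * (n * T)) + 108 * (n * T) ∎))
  where
  open ≤-Reasoning
  e₁ : ∀ n T → 8 * (12 * (n * n) + 4 * (T * T)) + 108 * (n * T) ≡
    2 * (24 * n * (2 * n) + 15 * T * T) + (2 * (T * T) + 108 * (n * T))
  e₁ = solve-∀
  e₂ : ∀ n T → 2 * (15 * T * (2 * n) + 24 * n * T) + (2 * (T * T) + 108 * (n * T)) ≡
    216 * (n * T) + 2 * (T * T)
  e₂ = solve-∀
  e₃ : ∀ n T → 216 * (n * T) + 12 * (n * T) ≡ 8 * (15 * (n * T)) + 108 * (n * T)
  e₃ = solve-∀
  lt : 2 * (T * T) < 12 * (n * T)
  lt = begin-strict
    2 * (T * T) ≤⟨ *-monoʳ-≤ 2 (*-monoˡ-≤ T T≤2n) ⟩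
    2 * (2 * n * T) ≡⟨ e n T ⟩
    4 * (n * T)
      <⟨ *-monoˡ-< (n * T) {{>-nonZero (*-mono-< {0} {n} {0} {T} 0<n 0<T)}}
           (s≤s (s≤s (s≤s (s≤s (s≤s (z≤n {7})))))) ⟩
    12 * (n * T) ∎
    where
    e : ∀ n T → 2 * (2 * n * T) ≡ 4 * (n * T)
    e = solve-∀
    0<n : 0 < n
    0<n = *-cancelˡ-< 2 0 n (<-≤-trans 0<T T≤2n)

-- Concavity: x ↦ (2T − x)(3x − 2T) exceeds nT at x = T and at x = 2n, hence at x = T + σ.
concave-bound : ∀ {T n σ P} → T ≡ σ + P → 0 < T → T + σ ≤ 2 * n → Below T n → n * T < P * (P + 4 * σ)
concave-bound {T} {n} {σ} {P} T≡ 0<T le b with 2 * T ≤? 6 * σ + 3 * β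
  where
  β : ℕ
  β = 2 * n ∸ (T + σ)
-- The chord of this concave quadratic from x = T + σ to x = 2n = T + σ + β has slope 2T - 6σ - 3β.
-- Here the slope is at most 0, so the value at T + σ is at least the value at 2n.
... | yes q = *-cancelˡ-< 2 _ _ (+-cancelʳ-< (2 * (15 * (n * T))) _ _ (begin-strict
  2 * (n * T) + 2 * (15 * (n * T))      ≡⟨ e₁ n T ⟩
  2 * (8 * (2 * n * T))                 ≤⟨ *-monoʳ-≤ 2 (key T≡ 2n≡ q) ⟩
  2 * (p + (3 * (2 * n * (2 * n)) + 4 * (T * T)))  ≡⟨ e₂ p n T ⟩
  2 * p + 2 * (12 * (n * n) + 4 * (T * T))
    <⟨ +-monoʳ-< (2 * p) (*-monoʳ-< 2 (below⇒quadratic (≤-trans (m≤m+n T σ) le) 0<T b)) ⟩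
  2 * p + 2 * (15 * (n * T)) ∎))
  where
  open ≤-Reasoning
  β p : ℕ
  β = 2 * n ∸ (T + σ)
  p = P * (P + 4 * σ)
  2n≡ : 2 * n ≡ T + σ + β
  2n≡ = sym (m+[n∸m]≡n le)
  e₁ : ∀ n T → 2 * (n * T) + 2 * (15 * (n * T)) ≡ 2 * (8 * (2 * n * T))
  e₁ = solve-∀
  e₂ : ∀ p n T → 2 * (p + (3 * (2 * n * (2 * n)) + 4 * (T * T))) ≡
    2 * p + 2 * (12 * (n * n) + 4 * (T * T))
  e₂ = solve-∀
  e₃ : ∀ σ P β → 8 * ((σ + P + σ + β) * (σ + P)) + (6 * σ + 3 * β) * β ≡
    P * (P + 4 * σ) + (3 * ((σ + P + σ + β) * (σ + P + σ + β)) + 4 * ((σ + P) * (σ + P)))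
      + 2 * (σ + P) * β
  e₃ = solve-∀
  key : ∀ {T N β} → T ≡ σ + P → N ≡ T + σ + β → 2 * T ≤ 6 * σ + 3 * β →
    8 * (N * T) ≤ P * (P + 4 * σ) + (3 * (N * N) + 4 * (T * T))
  key {_} {_} {β} refl refl q = +-cancelʳ-≤ (2 * (σ + P) * β) _ _ (begin
    8 * ((σ + P + σ + β) * (σ + P)) + 2 * (σ + P) * β
      ≤⟨ +-monoʳ-≤ (8 * ((σ + P + σ + β) * (σ + P))) (*-monoˡ-≤ β q) ⟩
    8 * ((σ + P + σ + β) * (σ + P)) + (6 * σ + 3 * β) * β
      ≡⟨ e₃ σ P β ⟩
    _ ∎)
-- Otherwise σ ≤ 2P, and the value at T + σ exceeds T² by σ (2P - σ) ≥ 0, while nT < T².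
... | no q = <-≤-trans (*-monoˡ-< T {{>-nonZero 0<T}} (below⇒< b)) (begin
  T * T                                  ≡⟨ cong (λ u → u * u) T≡ ⟩
  (σ + P) * (σ + P)                      ≡⟨ e₁ σ P ⟩
  σ * σ + (P * P + 2 * σ * P)            ≤⟨ +-monoˡ-≤ _ (*-monoʳ-≤ σ σ≤2P) ⟩
  σ * (2 * P) + (P * P + 2 * σ * P)      ≡⟨ e₂ σ P ⟩
  P * (P + 4 * σ) ∎)
  where
  open ≤-Reasoning
  e₁ : ∀ σ P → (σ + P) * (σ + P) ≡ σ * σ + (P * P + 2 * σ * P)
  e₁ = solve-∀
  e₂ : ∀ σ P → σ * (2 * P) + (P * P + 2 * σ * P) ≡ P * (P + 4 * σ)
  e₂ = solve-∀
  e₃ : ∀ σ → 6 * σ ≡ 2 * σ + 4 * σ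
  e₃ = solve-∀
  σ≤2P : σ ≤ 2 * P
  σ≤2P = ≤-trans (m≤m+n σ (3 * σ)) (+-cancelˡ-≤ (2 * σ) _ _ (begin
    2 * σ + 4 * σ ≡⟨ sym (e₃ σ) ⟩
    6 * σ ≤⟨ m≤m+n _ _ ⟩
    6 * σ + 3 * (2 * n ∸ (T + σ)) ≤⟨ ≰⇒≥ q ⟩
    2 * T ≡⟨ cong (2 *_) T≡ ⟩
    2 * (σ + P) ≡⟨ *-distribˡ-+ 2 σ P ⟩
    2 * σ + 2 * P ∎))

-- For a matching of the non-own pairs of a column with d + k edges and i unmatched rows, where w
-- counts ordered own pairs; the last hypothesis is the conclusion of erdős-gallai.
own-large : ∀ {t n d k i w} → 0 < t → Below (t * t) n →
  suc t ≤ d + k + i → (2 * (d + k) + i) * t < 2 * n →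
  (d + i) * (d + i) + 2 * (k * (d + 2 * i)) ≤ w + (d + i) + 4 * k → n < w
own-large {t} {n} {d} {k} {i} {w} 0<t b cov small own with 3 + k ≤? 2 * i
-- Here `own` yields (r + 1)² ≤ w + (r + 1) for r + 1 = d + k + i, hence w ≥ r (r + 1) ≥ t² > n.
... | yes q = <-≤-trans (below⇒< b) (begin
  t * t        ≤⟨ *-mono-≤ t≤r (m≤n⇒m≤1+n t≤r) ⟩
  r * suc r    ≤⟨ +-cancelʳ-≤ (suc r) _ _ r*≤ ⟩
  w            ∎)
  where
  open ≤-Reasoning
  r : ℕ
  r = d + k + i ∸ 1
  r≡ : suc r ≡ d + k + i
  r≡ = m+[n∸m]≡n (≤-trans (s≤s z≤n) cov)
  t≤r : t ≤ r
  t≤r = s≤s⁻¹ (≤-trans cov (≤-reflexive (sym r≡)))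
  e₀ : ∀ r → r * suc r + suc r ≡ suc r * suc r
  e₀ r = +-comm (r * suc r) (suc r)
  e₁ : ∀ d k i → (d + k + i) * (d + k + i) + 3 * k ≡
    (d + i) * (d + i) + 2 * (k * (d + i)) + k * (3 + k)
  e₁ = solve-∀
  e₂ : ∀ d k i → (d + i) * (d + i) + 2 * (k * (d + i)) + k * (2 * i) ≡
    (d + i) * (d + i) + 2 * (k * (d + 2 * i))
  e₂ = solve-∀
  e₃ : ∀ w d k i → w + (d + i) + 4 * k ≡ w + (d + k + i) + 3 * k
  e₃ = solve-∀
  r*≤ : r * suc r + suc r ≤ w + suc r
  r*≤ = begin
    r * suc r + suc r ≡⟨ e₀ r ⟩
    suc r * suc r     ≡⟨ cong (λ u → u * u) r≡ ⟩
    (d + k + i) * (d + k + i) ≤⟨ +-cancelʳ-≤ (3 * k) _ _ (begin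
       (d + k + i) * (d + k + i) + 3 * k ≡⟨ e₁ d k i ⟩
       (d + i) * (d + i) + 2 * (k * (d + i)) + k * (3 + k)
         ≤⟨ +-monoʳ-≤ ((d + i) * (d + i) + 2 * (k * (d + i))) (*-monoʳ-≤ k q) ⟩
       (d + i) * (d + i) + 2 * (k * (d + i)) + k * (2 * i) ≡⟨ e₂ d k i ⟩
       (d + i) * (d + i) + 2 * (k * (d + 2 * i)) ≤⟨ own ⟩
       w + (d + i) + 4 * k ≡⟨ e₃ w d k i ⟩
       w + (d + k + i) + 3 * k ∎) ⟩
    w + (d + k + i) ≡⟨ cong (w +_) (sym r≡) ⟩
    w + suc r ∎
-- If every row is matched, the column has 2 (d + k) ≥ 2t rows by `cov`, so its size times t is at
-- least 2t² > 2n.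
own-large {t} {n} {d} {k} {zero} {w} 0<t b cov small own | no q = contradiction small (≤⇒≯ (begin
  2 * n ≤⟨ *-monoʳ-≤ 2 (<⇒≤ (below⇒< b)) ⟩
  2 * (t * t) ≡⟨ sym (*-assoc 2 t t) ⟩
  2 * t * t
    ≤⟨ *-monoˡ-≤ t (*-monoʳ-≤ 2 (≤-trans (n≤1+n t) (≤-trans cov (≤-reflexive (+-identityʳ (d + k)))))) ⟩
  2 * (d + k) * t ≡⟨ cong (_* t) (sym (+-identityʳ (2 * (d + k)))) ⟩
  (2 * (d + k) + 0) * t ∎))
  where open ≤-Reasoning
-- Now i is one less than the number of unmatched rows, and 2i ≤ k. The column has t + s + 1 rows
-- and i = ρ + 2y, so w ≥ i (i + 4μ) ≥ ρ (ρ + 4s), which `concave-bound` with σ = st and P = ρt puts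
-- above n.
own-large {t} {n} {d} {k} {suc i} {w} 0<t b cov small own | no q =
  <-≤-trans (*-cancelʳ-< (t * t) n (ρ * (ρ + 4 * s)) nT<) (begin
  ρ * (ρ + 4 * s)    ≤⟨ m≤m+n _ _ ⟩
  ρ * (ρ + 4 * s) + (4 * y * y + 8 * y * μ)  ≡⟨ e₁ ρ y μ ⟩
  (ρ + 2 * y) * (ρ + 2 * y + 4 * μ) ≡⟨ cong (λ u → u * (u + 4 * μ)) (sym i≡) ⟩
  i * (i + 4 * μ)  ≤⟨ i*≤w ⟩
  w ∎)
  where
  open ≤-Reasoning
  μ y s ρ : ℕ
  μ = d + k
  y = μ + i ∸ t
  s = y + μ
  ρ = t ∸ s
  e₁ : ∀ ρ y μ → ρ * (ρ + 4 * (y + μ)) + (4 * y * y + 8 * y * μ) ≡ (ρ + 2 * y) * (ρ + 2 * y + 4 * μ)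
  e₁ = solve-∀
  μ+i≡ : μ + i ≡ t + y
  μ+i≡ = sym (m+[n∸m]≡n (s≤s⁻¹ (≤-trans cov (≤-reflexive (+-suc μ i)))))
  v≡ : 2 * μ + suc i ≡ suc (t + s)
  v≡ = begin-equality
    2 * μ + suc i ≡⟨ a₁ μ i ⟩
    suc (μ + i + μ) ≡⟨ cong (λ u → suc (u + μ)) μ+i≡ ⟩
    suc (t + y + μ) ≡⟨ cong suc (+-assoc t y μ) ⟩
    suc (t + s) ∎
    where
    a₁ : ∀ μ i → 2 * μ + suc i ≡ suc (μ + i + μ)
    a₁ = solve-∀
  [t+s]t< : (t + s) * t < 2 * n
  [t+s]t< = ≤-<-trans (*-monoˡ-≤ t (≤-trans (n≤1+n _) (≤-reflexive (sym v≡)))) small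
  s≤t : s ≤ t
  s≤t = +-cancelˡ-≤ t s t (*-cancelʳ-≤ (t + s) (t + t) t {{>-nonZero 0<t}} (begin
    (t + s) * t ≤⟨ <⇒≤ [t+s]t< ⟩
    2 * n ≤⟨ *-monoʳ-≤ 2 (<⇒≤ (below⇒< b)) ⟩
    2 * (t * t) ≡⟨ a₁ t ⟩
    (t + t) * t ∎))
    where
    a₁ : ∀ t → 2 * (t * t) ≡ (t + t) * t
    a₁ = solve-∀
  t≡ : t ≡ s + ρ
  t≡ = sym (m+[n∸m]≡n s≤t)
  i≡ : i ≡ ρ + 2 * y
  i≡ = +-cancelˡ-≡ μ i (ρ + 2 * y) (begin-equality
    μ + i ≡⟨ μ+i≡ ⟩
    t + y ≡⟨ cong (_+ y) t≡ ⟩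
    y + μ + ρ + y ≡⟨ a₁ y μ ρ ⟩
    μ + (ρ + 2 * y) ∎)
    where
    a₁ : ∀ y μ ρ → y + μ + ρ + y ≡ μ + (ρ + 2 * y)
    a₁ = solve-∀
  nT< : n * (t * t) < ρ * (ρ + 4 * s) * (t * t)
  nT< = <-≤-trans
    (concave-bound {t * t} {n} {s * t} {ρ * t}
      (trans (cong (_* t) t≡) (*-distribʳ-+ t s ρ)) (*-mono-< {0} {t} {0} {t} 0<t 0<t)
      (≤-trans (≤-reflexive (sym (*-distribʳ-+ t t s))) (<⇒≤ [t+s]t<)) b)
    (≤-reflexive (a₁ ρ s t))
    where
    a₁ : ∀ ρ s t → ρ * t * (ρ * t + 4 * (s * t)) ≡ ρ * (ρ + 4 * s) * (t * t)
    a₁ = solve-∀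
  2i≤k : 2 * i ≤ k
  2i≤k = +-cancelˡ-≤ 2 _ _ (≤-trans (≤-reflexive (a₁ i)) (s≤s⁻¹ (≰⇒> q)))
    where
    a₁ : ∀ i → 2 + 2 * i ≡ 2 * suc i
    a₁ = solve-∀
  i*≤w : i * (i + 4 * μ) ≤ w
  i*≤w = +-cancelʳ-≤ ((d + suc i) + 4 * k) _ _ (begin
    i * (i + 4 * (d + k)) + ((d + suc i) + 4 * k) ≡⟨ a₁ d k i ⟩
    2 * i * d + (i * i + 2 * d * i + 4 * (i * k) + d + suc i + 4 * k)
      ≤⟨ +-monoˡ-≤ _ (*-monoˡ-≤ d 2i≤k) ⟩
    k * d + (i * i + 2 * d * i + 4 * (i * k) + d + suc i + 4 * k)
      ≤⟨ m≤m+n _ (d * d + d + k * d + i) ⟩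
    k * d + (i * i + 2 * d * i + 4 * (i * k) + d + suc i + 4 * k) + (d * d + d + k * d + i)
      ≡⟨ a₂ d k i ⟩
    (d + suc i) * (d + suc i) + 2 * (k * (d + 2 * suc i)) ≤⟨ own ⟩
    w + (d + suc i) + 4 * k ≡⟨ +-assoc w _ _ ⟩
    w + ((d + suc i) + 4 * k) ∎)
    where
    a₁ : ∀ d k i → i * (i + 4 * (d + k)) + ((d + suc i) + 4 * k) ≡
      2 * i * d + (i * i + 2 * d * i + 4 * (i * k) + d + suc i + 4 * k)
    a₁ = solve-∀
    a₂ : ∀ d k i → k * d + (i * i + 2 * d * i + 4 * (i * k) + d + suc i + 4 * k) + (d * d + d + k * d + i) ≡
      (d + suc i) * (d + suc i) + 2 * (k * (d + 2 * suc i))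
    a₂ = solve-∀

-- With u = t + 2, the assumption v ≥ 2n/u gives n′/n ≤ 1 - 2/u ≤ (1 - 1/u)², so the ratio of n to
-- the squared parameter does not grow when u drops to u - 1.
below-step : ∀ {t n v n′} → v + n′ ≡ n → 2 * n ≤ v * suc (suc t) →
  Below (suc (suc t) * suc (suc t)) n → Below (suc t * suc t) n′
below-step {t} {n} {v} {n′} v+n′≡n big =
  below-scale (s≤s z≤n) (s≤s z≤n) (+-cancelʳ-≤ (v * u * u) _ _ (begin
  n′ * (u * u) + v * u * u      ≡⟨ e₁ n′ v u ⟩
  (v + n′) * (u * u)            ≡⟨ cong (_* (u * u)) v+n′≡n ⟩
  n * (u * u)                   ≤⟨ m≤m+n _ n ⟩
  n * (u * u) + n               ≡⟨ e₂ n t ⟩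
  n * (suc t * suc t) + 2 * n * u ≤⟨ +-monoʳ-≤ (n * (suc t * suc t)) (*-monoˡ-≤ u big) ⟩
  n * (suc t * suc t) + v * u * u ∎))
  where
  open ≤-Reasoning
  u : ℕ
  u = suc (suc t)
  e₁ : ∀ n′ v u → n′ * (u * u) + v * u * u ≡ (v + n′) * (u * u)
  e₁ = solve-∀
  e₂ : ∀ n t → n * (suc (suc t) * suc (suc t)) + n ≡ n * (suc t * suc t) + 2 * n * suc (suc t)
  e₂ = solve-∀

-- Finite sums

private variable
  A B : Set

∑ : List A → (A → ℕ) → ℕ
∑ xs f = sum (map f xs)

∑-↭ : ∀ {xs ys : List A} (f : A → ℕ) → xs ↭ ys → ∑ xs f ≡ ∑ ys f
∑-↭ f p = sum-↭ (map⁺ f p)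

∑-++ : ∀ (xs ys : List A) (f : A → ℕ) → ∑ (xs ++ ys) f ≡ ∑ xs f + ∑ ys f
∑-++ xs ys f = trans (cong sum (map-++ f xs ys)) (sum-++ (map f xs) (map f ys))

∑-mono : ∀ {xs : List A} {f g : A → ℕ} → (∀ {x} → x ∈ xs → f x ≤ g x) → ∑ xs f ≤ ∑ xs g
∑-mono {xs = []} h = z≤n
∑-mono {xs = x ∷ xs} h = +-mono-≤ (h (here refl)) (∑-mono (h ∘ there))

∑-const : ∀ (xs : List A) c → ∑ xs (λ _ → c) ≡ length xs * c
∑-const [] c = refl
∑-const (x ∷ xs) c = cong (c +_) (∑-const xs c)

∑-+ : ∀ (xs : List A) (f g : A → ℕ) → ∑ xs (λ x → f x + g x) ≡ ∑ xs f + ∑ xs g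
∑-+ [] f g = refl
∑-+ (x ∷ xs) f g = trans (cong (f x + g x +_) (∑-+ xs f g)) (e (f x) (g x) (∑ xs f) (∑ xs g))
  where
  e : ∀ a b c d → a + b + (c + d) ≡ a + c + (b + d)
  e = solve-∀

∑-swap : ∀ (xs : List A) (ys : List B) (f : A → B → ℕ) →
  ∑ xs (λ x → ∑ ys (f x)) ≡ ∑ ys (λ y → ∑ xs (λ x → f x y))
∑-swap [] ys f = sym (trans (∑-const ys 0) (*-zeroʳ (length ys)))
∑-swap (x ∷ xs) ys f = trans (cong (∑ ys (f x) +_) (∑-swap xs ys f))
  (sym (∑-+ ys (f x) (λ y → ∑ xs (λ x′ → f x′ y))))

∑-filter-≤ : ∀ {P : A → Set} (P? : Decidable P) xs (f : A → ℕ) → ∑ (filter P? xs) f ≤ ∑ xs f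
∑-filter-≤ P? [] f = z≤n
∑-filter-≤ P? (x ∷ xs) f with P? x
... | yes _ = +-monoʳ-≤ (f x) (∑-filter-≤ P? xs f)
... | no _  = ≤-trans (∑-filter-≤ P? xs f) (m≤n+m _ (f x))

𝟙 : {P : Set} → Dec P → ℕ
𝟙 (yes _) = 1
𝟙 (no _)  = 0

𝟙-true : {P : Set} (P? : Dec P) → P → 𝟙 P? ≡ 1
𝟙-true (yes _) _ = refl
𝟙-true (no ¬p) p = contradiction p ¬p

𝟙-cong : {P Q : Set} (P? : Dec P) (Q? : Dec Q) → (P → Q) → (Q → P) → 𝟙 P? ≡ 𝟙 Q?
𝟙-cong (yes _) (yes _) _ _ = refl
𝟙-cong (yes p) (no ¬q) f _ = contradiction (f p) ¬q
𝟙-cong (no ¬p) (yes q) _ g = contradiction (g q) ¬p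
𝟙-cong (no _) (no _) _ _ = refl

𝟙-false : {P : Set} (P? : Dec P) → ¬ P → 𝟙 P? ≡ 0
𝟙-false (yes p) ¬p = contradiction p ¬p
𝟙-false (no _)  _  = refl

module _ {P : A → Set} (P? : Decidable P) where

  length-filter-∑ : ∀ xs → length (filter P? xs) ≡ ∑ xs (𝟙 ∘ P?)
  length-filter-∑ [] = refl
  length-filter-∑ (x ∷ xs) with P? x
  ... | yes _ = cong suc (length-filter-∑ xs)
  ... | no _  = length-filter-∑ xs

  length-filter-¬ : ∀ xs → length (filter P? xs) + length (filter (¬? ∘ P?) xs) ≡ length xs
  length-filter-¬ [] = refl
  length-filter-¬ (x ∷ xs) with P? x
  ... | yes _ = cong suc (length-filter-¬ xs)
  ... | no _  = trans (+-suc _ _) (cong suc (length-filter-¬ xs))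

  ∑𝟙-none : ∀ {xs} → (∀ {x} → x ∈ xs → ¬ P x) → ∑ xs (𝟙 ∘ P?) ≡ 0
  ∑𝟙-none {xs} none = n≤0⇒n≡0 (≤-trans
    (∑-mono {xs = xs} {g = λ _ → 0} (λ {x} x∈ → ≤-reflexive (𝟙-false (P? x) (none x∈))))
    (≤-reflexive (trans (∑-const xs 0) (*-zeroʳ (length xs)))))

  ∑𝟙-some : ∀ {xs} → Any P xs → 1 ≤ ∑ xs (𝟙 ∘ P?)
  ∑𝟙-some {x ∷ xs} (here p) = ≤-trans (≤-reflexive (sym (𝟙-true (P? x) p))) (m≤m+n _ _)
  ∑𝟙-some {x ∷ xs} (there a) = ≤-trans (∑𝟙-some a) (m≤n+m _ (𝟙 (P? x)))

  ∑𝟙-unique : ∀ {xs} → Unique xs → (∀ {x y} → x ∈ xs → y ∈ xs → P x → P y → x ≡ y) →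
    ∑ xs (𝟙 ∘ P?) ≤ 1
  ∑𝟙-unique [] _ = z≤n
  ∑𝟙-unique {x ∷ xs} (x∉ ∷ u) same with P? x
  ... | no _  = ∑𝟙-unique u (λ y∈ z∈ → same (there y∈) (there z∈))
  ... | yes p = s≤s (≤-reflexive (∑𝟙-none λ y∈ q → All.lookup x∉ y∈ (same (here refl) (there y∈) p q)))

-- Lists up to permutation

∈⇒↭ : ∀ {x : A} {xs} → x ∈ xs → ∃ λ ys → xs ↭ x ∷ ys
∈⇒↭ x∈ with us , vs , refl ← ∈-∃++ x∈ = us ++ vs , shift _ us vs

∈∈⇒↭ : ∀ {x y : A} {xs} → x ∈ xs → y ∈ xs → x ≢ y → ∃ λ ys → xs ↭ x ∷ y ∷ ys
∈∈⇒↭ x∈ y∈ x≢y with ys , p ← ∈⇒↭ x∈ with ∈-resp-↭ p y∈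
... | here y≡x   = contradiction (sym y≡x) x≢y
... | there y∈ys with zs , q ← ∈⇒↭ y∈ys = zs , ↭-trans p (prep _ q)

Unique-resp-↭ : ∀ {xs ys : List A} → xs ↭ ys → Unique xs → Unique ys
Unique-resp-↭ p = Permₛ.Unique-resp-↭ (setoid _) (↭⇒↭ₛ p)

Unique⇒∉ : ∀ {x : A} {xs ys} → xs ↭ x ∷ ys → Unique xs → x ∉ ys × Unique ys
Unique⇒∉ p u with x∉ ∷ u′ ← Unique-resp-↭ p u = (λ x∈ → All.lookup x∉ x∈ refl) , u′

Unique-++⁻ʳ : ∀ (xs : List A) {ys} → Unique (xs ++ ys) → Unique ys
Unique-++⁻ʳ [] u = u
Unique-++⁻ʳ (x ∷ xs) (_ ∷ u) = Unique-++⁻ʳ xs u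

∑-≤1-zero : ∀ {xs : List A} {f : A → ℕ} {x} → (∀ y → f y ≤ 1) → x ∈ xs → f x ≡ 0 →
  suc (∑ xs f) ≤ length xs
∑-≤1-zero {xs = xs} {f} {x} f≤1 x∈ fx≡0 with ys , p ← ∈⇒↭ x∈ = begin
  suc (∑ xs f)        ≡⟨ cong suc (∑-↭ f p) ⟩
  suc (f x + ∑ ys f)  ≡⟨ cong (λ u → suc (u + ∑ ys f)) fx≡0 ⟩
  suc (∑ ys f)        ≤⟨ s≤s (∑-mono {xs = ys} {g = λ _ → 1} (λ {y} _ → f≤1 y)) ⟩
  suc (∑ ys (λ _ → 1)) ≡⟨ cong suc (trans (∑-const ys 1) (*-identityʳ _)) ⟩
  suc (length ys)     ≡⟨ sym (↭-length p) ⟩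
  length xs           ∎
  where open ≤-Reasoning

-- Matchings

module Matching {V : Set} (_≟ᵥ_ : DecidableEquality V) {E : V → V → Set}
  (E? : ∀ x y → Dec (E x y)) (E-sym : ∀ {x y} → E x y → E y x) where

  private open module S = CMSolver (++-commutativeMonoid {A = V}) using (solve; _⊕_; _⊜_)

  nonadj : V → V → ℕ
  nonadj x y = 𝟙 (¬? (E? x y))

  nonadj-sym : ∀ x y → nonadj x y ≡ nonadj y x
  nonadj-sym x y = 𝟙-cong (¬? (E? x y)) (¬? (E? y x)) (_∘ E-sym) (_∘ E-sym)

  nonadjacencies : List V → List V → ℕ
  nonadjacencies xs ys = ∑ xs λ x → ∑ ys (nonadj x)

  ends : List (V × V) → List V
  ends [] = []
  ends ((x , y) ∷ P) = x ∷ y ∷ ends P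

  Edge : V × V → Set
  Edge (x , y) = E x y

  -- The permutation uses each vertex exactly once, so for a duplicate-free `xs` the edges are
  -- disjoint and none is a loop, although `E` may have loops.
  IsMatching : List V → List (V × V) → List V → Set
  IsMatching xs P I = ends P ++ I ↭ xs × All Edge P

  -- Since |xs| = 2|P| + |I|, leaving the fewest vertices unmatched is the same as having the most
  -- edges.
  Maximum : List V → List V → Set
  Maximum xs I = ∀ {Q J} → IsMatching xs Q J → length I ≤ length J

  ends-++ : ∀ P Q → ends (P ++ Q) ≡ ends P ++ ends Q
  ends-++ [] Q = refl
  ends-++ (_ ∷ P) Q = cong (λ u → _ ∷ _ ∷ u) (ends-++ P Q)

  ends-↭-++ : ∀ P → ends P ↭ map proj₁ P ++ map proj₂ P
  ends-↭-++ [] = ↭-refl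
  ends-↭-++ ((x , y) ∷ P) = prep x (↭-trans (prep y (ends-↭-++ P))
    (↭-sym (shift y (map proj₁ P) (map proj₂ P))))

  ends-↭ : ∀ {P Q} → P ↭ Q → ends P ↭ ends Q
  ends-↭ {P} {Q} p = ↭-trans (ends-↭-++ P)
    (↭-trans (++⁺ (map⁺ proj₁ p) (map⁺ proj₂ p)) (↭-sym (ends-↭-++ Q)))

  length-ends : ∀ P → length (ends P) ≡ 2 * length P
  length-ends [] = refl
  length-ends (_ ∷ P) = trans (cong (2 +_) (length-ends P)) (sym (*-suc 2 (length P)))

  -- If no matching were maximum, each could be improved, and the number of unmatched vertices,
  -- bounded by `c`, would decrease forever.
  ¬¬maximum : ∀ xs → ¬ ¬ ∃₂ λ P I → IsMatching xs P I × Maximum xs I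
  ¬¬maximum xs = go (length xs) [] xs ≤-refl (↭-refl , [])
    where
    go : ∀ c P I → length I ≤ c → IsMatching xs P I →
      ¬ ¬ ∃₂ λ P I → IsMatching xs P I × Maximum xs I
    go zero P I I≤0 m none = none (P , I , m , λ _ → ≤-trans I≤0 z≤n)
    go (suc c) P I I≤c m none = none (P , I , m , max)
      where
      max : Maximum xs I
      max {Q} {J} m′ with length I ≤? length J
      ... | yes p = p
      ... | no p  = ⊥-elim (go c Q J (s≤s⁻¹ (≤-trans (≰⇒> p) I≤c)) m′ none)

  -- `FewNeighbours` expresses at most one neighbour in `I` as a lower bound on non-neighbours, the
  -- quantity that is summed later.
  TwoNeighbours FewNeighbours : List V → V → Set
  TwoNeighbours I x = ∃₂ λ a b → a ∈ I × b ∈ I × a ≢ b × E x a × E x b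
  FewNeighbours I x = length I ≤ suc (∑ I (nonadj x))

  isolated⇒∑ : ∀ {I x} → (∀ {a} → a ∈ I → ¬ E x a) → length I ≤ ∑ I (nonadj x)
  isolated⇒∑ {I} {x} none = ≤-trans
    (≤-reflexive (sym (trans (∑-const I 1) (*-identityʳ _))))
    (∑-mono λ {a} a∈ → ≤-reflexive (sym (𝟙-true (¬? (E? x a)) (none a∈))))

  neighbours : ∀ {I} → Unique I → ∀ x → TwoNeighbours I x ⊎ FewNeighbours I x
  neighbours [] x = inj₂ z≤n
  neighbours {a ∷ I} (a∉ ∷ u) x with E? x a
  ... | no ¬e with neighbours u x
  ...   | inj₁ (b , c , b∈ , c∈ , rest) = inj₁ (b , c , there b∈ , there c∈ , rest)
  ...   | inj₂ few = inj₂ (s≤s few)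
  neighbours {a ∷ I} (a∉ ∷ u) x | yes e with any? (E? x) I
  ... | yes p with b , b∈ , e′ ← find p =
    inj₁ (a , b , here refl , there b∈ , All.lookup a∉ b∈ , e , e′)
  ... | no p = inj₂ (s≤s (isolated⇒∑ λ b∈ e′ → p (lose b∈ e′)))

  neighbour≢ : ∀ {I x} → TwoNeighbours I x → ∀ c → ∃ λ a → a ∈ I × a ≢ c × E x a
  neighbour≢ (a , b , a∈ , b∈ , a≢b , ea , eb) c with a ≟ᵥ c
  ... | no a≢c = a , a∈ , a≢c , ea
  ... | yes refl = b , b∈ , ≢-sym a≢b , eb

  -- Heavy edges are oriented: the endpoint with two unmatched neighbours comes first, so
  -- `map proj₂` collects the vertices that can be freed.
  Heavy Light : List V → V × V → Set
  Heavy I (x , y) = E x y × TwoNeighbours I x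
  Light I (x , y) = E x y × FewNeighbours I x × FewNeighbours I y

  split : ∀ {I} → Unique I → ∀ {P} → All Edge P → ∃₂ λ T₁ T₂ →
    ends T₁ ++ ends T₂ ↭ ends P × All (Heavy I) T₁ × All (Light I) T₂
  split u [] = [] , [] , ↭-refl , [] , []
  split u {(x , y) ∷ P} (e ∷ es) with T₁ , T₂ , p , h , l ← split u es | neighbours u x | neighbours u y
  ... | inj₁ two | _ = (x , y) ∷ T₁ , T₂ , prep x (prep y p) , (e , two) ∷ h , l
  ... | inj₂ _ | inj₁ two = (y , x) ∷ T₁ , T₂ , swap y x p , (E-sym e , two) ∷ h , l
  ... | inj₂ fx | inj₂ fy = T₁ , (x , y) ∷ T₂ ,
    ↭-trans (↭-trans (shift x (ends T₁) _) (prep x (shift y (ends T₁) _))) (prep x (prep y p)) ,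
    h , (e , fx , fy) ∷ l

  -- Alternating paths through heavy edges

  module _ {I : List V} {T : List (V × V)} (heavy : All (Heavy I) T) where

    -- Alternating along a — x — y with a ∈ I frees the partner y of a heavy endpoint x.
    Freed : V → V → Set
    Freed b c = ∃₂ λ T′ J → ends T′ ++ b ∷ c ∷ J ↭ ends T ++ I × All Edge T′ ×
      length I ≡ 2 + length J

    free-comm : ∀ {b c} → Freed b c → Freed c b
    free-comm {b} {c} (T′ , J , p , es , l) =
      T′ , J , ↭-trans (++⁺ˡ (ends T′) (swap c b ↭-refl)) p , es , l

    -- Of the two unmatched neighbours of x, one, a, differs from the vertex b that has to stay
    -- free. Trading the edge xy for xa frees y.
    free-I-Y : ∀ {b c} → b ∈ I → c ∈ map proj₂ T → Freed b c
    free-I-Y {b} b∈ c∈ with (x , y) , xy∈ , refl ← ∈-map⁻ proj₂ c∈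
      with T₀ , p ← ∈⇒↭ xy∈
      with a , a∈ , a≢b , xa ← neighbour≢ (proj₂ (All.lookup heavy xy∈)) b
      with J , q ← ∈∈⇒↭ a∈ b∈ a≢b
      with _ ∷ es ← All-resp-↭ p heavy =
        (x , a) ∷ T₀ , J ,
        ↭-trans (solve 6 (λ x a y b t j → ((x ⊕ a ⊕ t) ⊕ b ⊕ y ⊕ j) ⊜ ((x ⊕ y ⊕ t) ⊕ a ⊕ b ⊕ j)) ↭-refl
            (x ∷ []) (a ∷ []) (y ∷ []) (b ∷ []) (ends T₀) J)
          (↭-sym (++⁺ (ends-↭ p) q)) ,
        xa ∷ All.map proj₁ es , ↭-length q

    -- Both heavy edges trade their second endpoints for unmatched vertices; x′ has two candidates,
    -- so a′ can be chosen different from a.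
    free-Y-Y : ∀ {b c} → b ∈ map proj₂ T → c ∈ map proj₂ T → b ≢ c → Freed b c
    free-Y-Y b∈ c∈ b≢c with (x , y) , xy∈ , refl ← ∈-map⁻ proj₂ b∈
      with (x′ , y′) , xy′∈ , refl ← ∈-map⁻ proj₂ c∈
      with T₀ , p ← ∈∈⇒↭ xy∈ xy′∈ (b≢c ∘ cong proj₂)
      with a , _ , a∈ , _ , _ , xa , _ ← proj₂ (All.lookup heavy xy∈)
      with a′ , a′∈ , a′≢a , xa′ ← neighbour≢ (proj₂ (All.lookup heavy xy′∈)) a
      with J , q ← ∈∈⇒↭ a∈ a′∈ (≢-sym a′≢a)
      with _ ∷ _ ∷ es ← All-resp-↭ p heavy =
        (x , a) ∷ (x′ , a′) ∷ T₀ , J ,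
        ↭-trans (solve 8 (λ x a y x′ a′ y′ t j →
            ((x ⊕ a ⊕ x′ ⊕ a′ ⊕ t) ⊕ y ⊕ y′ ⊕ j) ⊜ ((x ⊕ y ⊕ x′ ⊕ y′ ⊕ t) ⊕ a ⊕ a′ ⊕ j)) ↭-refl
            (x ∷ []) (a ∷ []) (y ∷ []) (x′ ∷ []) (a′ ∷ []) (y′ ∷ []) (ends T₀) J)
          (↭-sym (++⁺ (ends-↭ p) q)) ,
        xa ∷ xa′ ∷ All.map proj₁ es , ↭-length q

    free : ∀ {b c} → b ∈ I ++ map proj₂ T → c ∈ I ++ map proj₂ T → b ≢ c → Freed b c
    free b∈ c∈ b≢c with ∈-++⁻ I b∈ | ∈-++⁻ I c∈
    ... | inj₁ bI | inj₁ cI with J , q ← ∈∈⇒↭ bI cI b≢c =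
      T , J , ++⁺ˡ (ends T) (↭-sym q) , All.map proj₁ heavy , ↭-length q
    ... | inj₁ bI | inj₂ cY = free-I-Y bI cY
    ... | inj₂ bY | inj₁ cI = free-comm (free-I-Y cI bY)
    ... | inj₂ bY | inj₂ cY = free-Y-Y bY cY b≢c

  -- Non-adjacencies forced by a maximum matching

  module _ {xs I T₁ T₂} (perm : ends T₁ ++ ends T₂ ++ I ↭ xs) (maximum : Maximum xs I)
    (heavy : All (Heavy I) T₁) (light : All (Light I) T₂) (unique : Unique xs) where

    private
      -- By free, any two of these vertices are missed together by some maximum matching.
      Out : List V
      Out = I ++ map proj₂ T₁

      xs↭ : xs ↭ map proj₁ T₁ ++ ends T₂ ++ Out
      xs↭ = ↭-trans (↭-sym perm) (↭-trans (++⁺ʳ (ends T₂ ++ I) (ends-↭-++ T₁))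
        (solve 4 (λ x y t i → ((x ⊕ y) ⊕ t ⊕ i) ⊜ (x ⊕ t ⊕ i ⊕ y)) ↭-refl
          (map proj₁ T₁) (map proj₂ T₁) (ends T₂) I))

      unique-Out : Unique Out
      unique-Out = Unique-++⁻ʳ (ends T₂) (Unique-++⁻ʳ (map proj₁ T₁) (Unique-resp-↭ xs↭ unique))

      larger : ∀ {T J} → ends T ++ J ↭ xs → All Edge T → length J < length I → ⊥
      larger p es lt = <⇒≱ lt (maximum (p , es))

      freed-perm : ∀ {T′ b c J} → ends T′ ++ b ∷ c ∷ J ↭ ends T₁ ++ I →
        ends T₂ ++ ends T′ ++ b ∷ c ∷ J ↭ xs
      freed-perm p = ↭-trans (++⁺ˡ (ends T₂) p) (↭-trans
        (solve 3 (λ s t i → (t ⊕ s ⊕ i) ⊜ (s ⊕ t ⊕ i)) ↭-refl (ends T₁) (ends T₂) I) perm)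

      -- A matching that misses b and c and is as large as the maximum would be enlarged by the edge
      -- bc.
      independent : ∀ {b c} → b ∈ Out → c ∈ Out → b ≢ c → ¬ E b c
      independent {b} {c} b∈ c∈ b≢c bc with T′ , J , p , es , l ← free heavy b∈ c∈ b≢c =
        larger {(b , c) ∷ T₂ ++ T′} {J}
          (↭-trans (↭-reflexive (cong (λ u → b ∷ c ∷ u ++ J) (ends-++ T₂ T′)))
            (↭-trans (solve 5 (λ b c t s j → (b ⊕ c ⊕ (t ⊕ s) ⊕ j) ⊜ (t ⊕ s ⊕ b ⊕ c ⊕ j)) ↭-refl
              (b ∷ []) (c ∷ []) (ends T₂) (ends T′) J) (freed-perm p)))
          (bc ∷ All.++⁺ (All.map proj₁ light) es) (subst (length J <_) (sym l) (m≤n⇒m≤1+n ≤-refl))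

      -- Otherwise b, z, w, c would be an augmenting path: in a maximum matching that misses b and
      -- c, the light edge zw could be replaced by zb and wc.
      no-exchange : ∀ {z w b c} → (z , w) ∈ T₂ → b ∈ Out → c ∈ Out → b ≢ c → E z b → ¬ E w c
      no-exchange {z} {w} {b} {c} zw∈ b∈ c∈ b≢c zb wc
        with T′ , J , p , es , l ← free heavy b∈ c∈ b≢c
        with T₃ , q ← ∈⇒↭ zw∈
        with _ ∷ ls ← All-resp-↭ q light =
        larger {(z , b) ∷ (w , c) ∷ T₃ ++ T′} {J}
          (↭-trans (↭-reflexive (cong (λ u → z ∷ b ∷ w ∷ c ∷ u ++ J) (ends-++ T₃ T′)))
            (↭-trans (solve 7 (λ z w b c t s j →
              (z ⊕ b ⊕ w ⊕ c ⊕ (t ⊕ s) ⊕ j) ⊜ ((z ⊕ w ⊕ t) ⊕ s ⊕ b ⊕ c ⊕ j)) ↭-refl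
              (z ∷ []) (w ∷ []) (b ∷ []) (c ∷ []) (ends T₃) (ends T′) J)
            (↭-trans (++⁺ʳ _ (↭-sym (ends-↭ q))) (freed-perm p))))
          (zb ∷ wc ∷ All.++⁺ (All.map proj₁ ls) es) (subst (length J <_) (sym l) (m≤n⇒m≤1+n ≤-refl))

      d k i j : ℕ
      d = length T₁
      k = length T₂
      i = length I
      j = d + i

      length-Out : length Out ≡ j
      length-Out = trans (length-++ I) (trans (cong (i +_) (length-map proj₂ T₁)) (+-comm i d))

      -- Independence concerns distinct vertices only, so b may still be adjacent to itself; the
      -- `suc` allows for this loop.
      Out-row : ∀ {b} → b ∈ Out → j ≤ suc (∑ Out (nonadj b))
      Out-row {b} b∈ with neighbours unique-Out b
      ... | inj₂ few = subst (_≤ suc (∑ Out (nonadj b))) length-Out few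
      ... | inj₁ two with a , a∈ , a≢b , ba ← neighbour≢ two b =
        contradiction ba (independent b∈ a∈ (≢-sym a≢b))

      Out-Out : j * j ≤ nonadjacencies Out Out + j
      Out-Out = begin
        j * j                 ≡⟨ cong (_* j) (sym length-Out) ⟩
        length Out * j        ≡⟨ sym (∑-const Out j) ⟩
        ∑ Out (λ _ → j)       ≤⟨ ∑-mono Out-row ⟩
        ∑ Out (λ b → 1 + ∑ Out (nonadj b)) ≡⟨ ∑-+ Out (λ _ → 1) _ ⟩
        ∑ Out (λ _ → 1) + nonadjacencies Out Out
          ≡⟨ cong (_+ nonadjacencies Out Out) (trans (∑-const Out 1) (trans (*-identityʳ _) length-Out)) ⟩
        j + nonadjacencies Out Out ≡⟨ +-comm j _ ⟩
        nonadjacencies Out Out + j ∎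
        where open ≤-Reasoning

      ∑-I≤Out : ∀ z → ∑ I (nonadj z) ≤ ∑ Out (nonadj z)
      ∑-I≤Out z = ≤-trans (m≤m+n _ _) (≤-reflexive (sym (∑-++ I (map proj₂ T₁) (nonadj z))))

      -- The vertex z misses all d + i vertices of `Out`, and w misses all but at most one of `I`.
      -- One more unit is given away to match the bound of the other case of `light-row`.
      one-isolated : ∀ {z w} → (∀ {b} → b ∈ Out → ¬ E z b) → FewNeighbours I w →
        d + 2 * i ≤ ∑ Out (nonadj z) + ∑ Out (nonadj w) + 2
      one-isolated {z} {w} none few = begin
        d + 2 * i ≡⟨ e d i ⟩
        j + i     ≤⟨ +-mono-≤ (subst (_≤ ∑ Out (nonadj z)) length-Out (isolated⇒∑ none)) few ⟩
        ∑ Out (nonadj z) + suc (∑ I (nonadj w)) ≤⟨ +-monoʳ-≤ (∑ Out (nonadj z)) (s≤s (∑-I≤Out w)) ⟩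
        ∑ Out (nonadj z) + suc (∑ Out (nonadj w)) ≤⟨ n≤1+n _ ⟩
        suc (∑ Out (nonadj z) + suc (∑ Out (nonadj w)))
          ≡⟨ e₂ (∑ Out (nonadj z)) (∑ Out (nonadj w)) ⟩
        ∑ Out (nonadj z) + ∑ Out (nonadj w) + 2 ∎
        where
        open ≤-Reasoning
        e : ∀ d i → d + 2 * i ≡ d + i + i
        e = solve-∀
        e₂ : ∀ a b → suc (a + suc b) ≡ a + b + 2
        e₂ = solve-∀

      -- If one end of a light edge has two neighbours in `Out`, a neighbour of the other end would
      -- differ from one of them and allow an exchange, so the other end has none. If neither end
      -- has two, each misses all but one vertex of `Out`.
      light-row : ∀ {z w} → (z , w) ∈ T₂ → d + 2 * i ≤ ∑ Out (nonadj z) + ∑ Out (nonadj w) + 2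
      light-row {z} {w} zw∈
        with _ , fz , fw ← All.lookup light zw∈ | neighbours unique-Out z | neighbours unique-Out w
      ... | _ | inj₁ two = one-isolated (λ b∈ zb → case neighbour≢ two _ of
              λ (a , a∈ , a≢b , wa) → no-exchange zw∈ b∈ a∈ (≢-sym a≢b) zb wa) fw
      ... | inj₁ two | inj₂ _ = ≤-trans (one-isolated {w} {z} (λ c∈ wc → case neighbour≢ two _ of
              λ (a , a∈ , a≢c , za) → no-exchange zw∈ a∈ c∈ a≢c za wc) fz)
              (≤-reflexive (cong (_+ 2) (+-comm (∑ Out (nonadj w)) _)))
      ... | inj₂ fz′ | inj₂ fw′ = begin
        d + 2 * i ≤⟨ m≤m+n _ d ⟩
        d + 2 * i + d ≡⟨ e d i ⟩
        j + j ≡⟨ cong₂ _+_ (sym length-Out) (sym length-Out) ⟩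
        length Out + length Out ≤⟨ +-mono-≤ fz′ fw′ ⟩
        suc (∑ Out (nonadj z)) + suc (∑ Out (nonadj w))
          ≡⟨ e₂ (∑ Out (nonadj z)) (∑ Out (nonadj w)) ⟩
        ∑ Out (nonadj z) + ∑ Out (nonadj w) + 2 ∎
        where
        open ≤-Reasoning
        e : ∀ d i → d + 2 * i + d ≡ d + i + (d + i)
        e = solve-∀
        e₂ : ∀ a b → suc a + suc b ≡ a + b + 2
        e₂ = solve-∀

      light-Out : ∀ T → (∀ {q} → q ∈ T → q ∈ T₂) →
        length T * (d + 2 * i) ≤ nonadjacencies (ends T) Out + 2 * length T
      light-Out [] _ = z≤n
      light-Out ((z , w) ∷ T) ⊆T₂ = begin
        (d + 2 * i) + length T * (d + 2 * i)
          ≤⟨ +-mono-≤ (light-row (⊆T₂ (here refl))) (light-Out T (⊆T₂ ∘ there)) ⟩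
        ∑ Out (nonadj z) + ∑ Out (nonadj w) + 2 + (nonadjacencies (ends T) Out + 2 * length T)
          ≡⟨ e (∑ Out (nonadj z)) (∑ Out (nonadj w)) (nonadjacencies (ends T) Out) (length T) ⟩
        ∑ Out (nonadj z) + (∑ Out (nonadj w) + nonadjacencies (ends T) Out) + 2 * suc (length T) ∎
        where
        open ≤-Reasoning
        e : ∀ a b c l → a + b + 2 + (c + 2 * l) ≡ a + (b + c) + 2 * suc l
        e = solve-∀

      nonadjacencies-sym : ∀ ys zs → nonadjacencies ys zs ≡ nonadjacencies zs ys
      nonadjacencies-sym ys zs = trans (∑-swap ys zs nonadj)
        (cong sum (map-cong (λ z → cong sum (map-cong (λ y → nonadj-sym y z) ys)) zs))

      nonadjacencies-++ : ∀ ys zs → nonadjacencies (ys ++ zs) (ys ++ zs) ≡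
        (nonadjacencies ys ys + nonadjacencies ys zs) + (nonadjacencies zs ys + nonadjacencies zs zs)
      nonadjacencies-++ ys zs = trans (∑-++ ys zs _) (cong₂ _+_ (row ys) (row zs))
        where
        row : ∀ us → nonadjacencies us (ys ++ zs) ≡ nonadjacencies us ys + nonadjacencies us zs
        row us = trans (cong sum (map-cong (λ u → ∑-++ ys zs (nonadj u)) us)) (∑-+ us _ _)

      nonadjacencies-↭ : ∀ {ys zs} → ys ↭ zs → nonadjacencies ys ys ≡ nonadjacencies zs zs
      nonadjacencies-↭ {ys} {zs} p = trans (∑-↭ _ p) (cong sum (map-cong (λ z → ∑-↭ (nonadj z) p) zs))

    -- Only the pairs inside `Out` and those between `Out` and the light ends, in both orders, are
    -- counted. The block of light ends against each other and all blocks meeting the first ends of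
    -- heavy edges are dropped.
    maximum-nonadjacencies : j * j + 2 * (k * (d + 2 * i)) ≤ nonadjacencies xs xs + j + 4 * k
    maximum-nonadjacencies = begin
      j * j + 2 * (k * (d + 2 * i))
        ≤⟨ +-mono-≤ Out-Out (*-monoʳ-≤ 2 (light-Out T₂ (λ q∈ → q∈))) ⟩
      (nonadjacencies Out Out + j) + 2 * (nonadjacencies L Out + 2 * k)
        ≡⟨ e (nonadjacencies Out Out) (nonadjacencies L Out) j k ⟩
      (nonadjacencies L Out + (nonadjacencies L Out + nonadjacencies Out Out)) + j + 4 * k
        ≡⟨ cong (λ u → (nonadjacencies L Out + (u + nonadjacencies Out Out)) + j + 4 * k)
             (nonadjacencies-sym L Out) ⟩
      (nonadjacencies L Out + (nonadjacencies Out L + nonadjacencies Out Out)) + j + 4 * k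
        ≤⟨ +-monoˡ-≤ (4 * k) (+-monoˡ-≤ j bound) ⟩
      nonadjacencies xs xs + j + 4 * k ∎
      where
      open ≤-Reasoning
      L X : List V
      L = ends T₂
      X = map proj₁ T₁
      e : ∀ a b j k → (a + j) + 2 * (b + 2 * k) ≡ (b + (b + a)) + j + 4 * k
      e = solve-∀
      bound : nonadjacencies L Out + (nonadjacencies Out L + nonadjacencies Out Out) ≤
        nonadjacencies xs xs
      bound = begin
        nonadjacencies L Out + (nonadjacencies Out L + nonadjacencies Out Out)
          ≤⟨ +-monoˡ-≤ _ (m≤n+m _ (nonadjacencies L L)) ⟩
        (nonadjacencies L L + nonadjacencies L Out) + (nonadjacencies Out L + nonadjacencies Out Out)
          ≡⟨ sym (nonadjacencies-++ L Out) ⟩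
        nonadjacencies (L ++ Out) (L ++ Out)
          ≤⟨ ≤-trans (m≤n+m _ (nonadjacencies (L ++ Out) X))
               (m≤n+m _ (nonadjacencies X X + nonadjacencies X (L ++ Out))) ⟩
        _ ≡⟨ sym (nonadjacencies-++ (X) (L ++ Out)) ⟩
        nonadjacencies (X ++ L ++ Out) (X ++ L ++ Out) ≡⟨ sym (nonadjacencies-↭ xs↭) ⟩
        nonadjacencies xs xs ∎

  -- d and k count the heavy and light edges of a maximum matching; the double negation spares the
  -- search for it, since only a decidable consequence will be used.
  erdős-gallai : ∀ {xs} → Unique xs → ¬ ¬ ∃ λ d → ∃ λ k → ∃₂ λ P I →
    IsMatching xs P I × length P ≡ d + k × 2 * (d + k) + length I ≡ length xs ×
    (d + length I) * (d + length I) + 2 * (k * (d + 2 * length I)) ≤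
      nonadjacencies xs xs + (d + length I) + 4 * k
  erdős-gallai {xs} u none = ¬¬maximum xs λ (P , I , (p , es) , max) →
    let T₁ , T₂ , q , heavy , light = split (Unique-++⁻ʳ (ends P) (Unique-resp-↭ (↭-sym p) u)) es
        r = ↭-trans (++⁺ʳ I q) p
        r′ = ↭-trans (↭-reflexive (sym (++-assoc (ends T₁) (ends T₂) I))) r
        r″ = ↭-trans (↭-reflexive (cong (_++ I) (ends-++ T₁ T₂))) r
    in none (length T₁ , length T₂ , T₁ ++ T₂ , I ,
      (r″ , All.++⁺ (All.map proj₁ heavy) (All.map proj₁ light)) , length-++ T₁ ,
      trans (cong (λ l → 2 * l + length I) (sym (length-++ T₁)))
        (trans (cong (_+ length I) (sym (length-ends (T₁ ++ T₂))))
          (trans (sym (length-++ (ends (T₁ ++ T₂)))) (↭-length r″))) ,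
      maximum-nonadjacencies r′ max heavy light u)

-- Cover-free families

module CoverFreeFamily {Row Col : Set} (_≟ʳ_ : DecidableEquality Row) (_≟ᶜ_ : DecidableEquality Col)
  (M : Row → Col → Bool) where

  private variable
    t : ℕ
    R R′ : List Row
    C C′ : List Col
    k : Col
    i : Row

  -- Lists select the rows and columns, so that deletions stay within one matrix `M`. The list `S`
  -- may be empty or have repetitions.
  CoverFree : ℕ → List Row → List Col → Set
  CoverFree t R C = ∀ {S k} → All (_∈ C) S → k ∈ C → k ∉ S → length S ≤ t →
    ∃ λ i → i ∈ R × M i k ≡ true × All (λ j → M i j ≡ false) S

  PrivateRow : List Col → Col → Row → Set
  PrivateRow C k i = M i k ≡ true × All (λ j → M i j ≡ true → j ≡ k) C

  privateRow? : ∀ C k → Decidable (PrivateRow C k)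
  privateRow? C k i = (M i k ≟ᵇ true) ×-dec all? (λ j → (M i j ≟ᵇ true) →-dec (j ≟ᶜ k)) C

  HasPrivate : List Row → List Col → Col → Set
  HasPrivate R C k = Any (PrivateRow C k) R

  hasPrivate? : ∀ R C → Decidable (HasPrivate R C)
  hasPrivate? R C k = any? (privateRow? C k) R

  -- This is the graph of non-own pairs of k. A loop at a row of k means that the row is not
  -- private.
  Shared : List Col → Col → Row → Row → Set
  Shared C k x y = Any (λ j → j ≢ k × M x j ≡ true × M y j ≡ true) C

  shared? : ∀ C k x y → Dec (Shared C k x y)
  shared? C k x y = any? (λ j → ¬? (j ≟ᶜ k) ×-dec (M x j ≟ᵇ true) ×-dec (M y j ≟ᵇ true)) C

  shared-sym : ∀ {x y} → Shared C k x y → Shared C k y x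
  shared-sym = Any.map λ (j≢k , p , q) → j≢k , q , p

  column : List Row → Col → List Row
  column R k = filter (λ i → M i k ≟ᵇ true) R

  outside : List Row → Col → List Row
  outside R k = filter (λ i → ¬? (M i k ≟ᵇ true)) R

  private module G C k = Matching _≟ʳ_ (shared? C k) shared-sym

  -- Covers from matchings

  ¬private⇒shared : ¬ HasPrivate R C k → i ∈ R → M i k ≡ true → Shared C k i i
  ¬private⇒shared {C = C} {k = k} {i = i} np i∈ ik with shared? C k i i
  ... | yes s = s
  ... | no ¬s = contradiction (lose i∈ (ik , All.tabulate only)) np
    where
    only : ∀ {j} → j ∈ C → M i j ≡ true → j ≡ k
    only {j} j∈ ij with j ≟ᶜ k
    ... | yes j≡k = j≡k
    ... | no j≢k  = contradiction (lose j∈ (j≢k , ij , ij)) ¬s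

  -- The column that witnesses an edge contains both of its ends, so one column per edge suffices.
  shared-cover : ∀ {P} → All (G.Edge C k) P → ∃ λ S →
    length S ≡ length P × All (λ j → j ∈ C × j ≢ k) S ×
    (∀ {i} → i ∈ G.ends C k P → Any (λ j → M i j ≡ true) S)
  shared-cover [] = [] , refl , [] , λ ()
  shared-cover {C = C} {k = k} {P = (x , y) ∷ P} (e ∷ es)
    with j , j∈ , j≢k , xj , yj ← find e | S , l , ok , cov ← shared-cover es =
    j ∷ S , cong suc l , (j∈ , j≢k) ∷ ok , cov′
    where
    cov′ : ∀ {i} → i ∈ G.ends C k ((x , y) ∷ P) → Any (λ j → M i j ≡ true) (j ∷ S)
    cov′ (here refl) = here xj
    cov′ (there (here refl)) = here yj
    cov′ (there (there i∈)) = there (cov i∈)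

  uncovered : ∀ {S} → All (λ j → M i j ≡ false) S → ¬ Any (λ j → M i j ≡ true) S
  uncovered (f ∷ _) (here t) = contradiction (trans (sym f) t) λ ()
  uncovered (_ ∷ fs) (there a) = uncovered fs a

  -- Without a private row each unmatched row carries a loop, so `shared-cover` applies to the
  -- matching edges and to these loops alike. Together they would cover k by |P| + |I| other
  -- columns, which must therefore exceed t.
  matching-size : CoverFree t R C → k ∈ C → ¬ HasPrivate R C k → ∀ {P I} →
    G.IsMatching C k (column R k) P I → t < length P + length I
  matching-size {t} {R} {C} {k} cf k∈ np {P} {I} (p , es) = ≰⇒> absurd
    where
    loop : ∀ {x} → x ∈ column R k → Shared C k x x
    loop x∈ with x∈R , xk ← ∈-filter⁻ (λ i → M i k ≟ᵇ true) x∈ = ¬private⇒shared np x∈R xk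
    loops : List (Row × Row)
    loops = map (λ x → x , x) I
    ∈-loops : ∀ {x J} → x ∈ J → x ∈ G.ends C k (map (λ x → x , x) J)
    ∈-loops (here refl) = here refl
    ∈-loops (there x∈)  = there (there (∈-loops x∈))
    absurd : ¬ length P + length I ≤ t
    absurd le
      with S₁ , l₁ , ok₁ , cov₁ ← shared-cover es
      with S₂ , l₂ , ok₂ , cov₂ ← shared-cover {P = loops}
             (All.map⁺ (All.tabulate λ i∈ → loop (∈-resp-↭ p (∈-++⁺ʳ _ i∈))))
      with i , i∈ , ik , avoid ← cf {S₁ ++ S₂} (All.map proj₁ (All.++⁺ ok₁ ok₂)) k∈
             (λ k∈S → proj₂ (All.lookup (All.++⁺ ok₁ ok₂) k∈S) refl)
             (≤-trans (≤-reflexive (trans (length-++ S₁) (cong₂ _+_ l₁ (trans l₂ (length-map _ I))))) le)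
      with ∈-++⁻ (G.ends C k P) (∈-resp-↭ (↭-sym p) (∈-filter⁺ (λ i → M i k ≟ᵇ true) i∈ ik))
    ... | inj₁ i∈P = uncovered avoid (Any.++⁺ˡ (cov₁ i∈P))
    ... | inj₂ i∈I = uncovered avoid (Any.++⁺ʳ S₁ (cov₂ (∈-loops i∈I)))

  -- The empty matching leaves every row of the column unmatched.
  column-size : CoverFree t R C → k ∈ C → ¬ HasPrivate R C k → t < length (column R k)
  column-size cf k∈ np = matching-size cf k∈ np {[]} (↭-refl , [])

  ownPairs : List Row → List Col → Col → ℕ
  ownPairs R C k = G.nonadjacencies C k (column R k) (column R k)

  ownPairs-large : Unique R → CoverFree t R C → k ∈ C → ¬ HasPrivate R C k → 0 < t →
    Below (t * t) (length R) → length (column R k) * t < 2 * length R → length R < ownPairs R C k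
  ownPairs-large {R} {t} {C} {k} uR cf k∈ np 0<t b small =
    -- The inequality is decidable, hence stable, which discharges the double negation.
    decidable-stable (length R <? ownPairs R C k) λ ≮ →
      G.erdős-gallai C k (Unique.filter⁺ (λ i → M i k ≟ᵇ true) uR)
        λ (d , l , P , I , m , P≡ , size , own) →
          ≮ (own-large {d = d} {l} {length I} 0<t b
            (subst (λ u → t < u + length I) P≡ (matching-size cf k∈ np m))
            (subst (λ v → v * t < 2 * length R) (sym size) small) own)

  -- Counting own pairs over all columns

  module _ (uC : Unique C) (np : ∀ {k} → k ∈ C → ¬ HasPrivate R C k) where

    private
      Own : Row → Row → Col → Set
      Own x y k = M x k ≡ true × M y k ≡ true × ¬ Shared C k x y

      own? : ∀ x y k → Dec (Own x y k)
      own? x y k = (M x k ≟ᵇ true) ×-dec (M y k ≟ᵇ true) ×-dec ¬? (shared? C k x y)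

      owners : Row → Row → ℕ
      owners x y = ∑ C (𝟙 ∘ own? x y)

      -- A second column containing both rows would itself witness that the pair is not own.
      owners≤1 : ∀ x y → owners x y ≤ 1
      owners≤1 x y = ∑𝟙-unique (own? x y) uC same
        where
        same : ∀ {j k} → j ∈ C → k ∈ C → Own x y j → Own x y k → j ≡ k
        same {j} {k} j∈ k∈ (xj , yj , _) (_ , _ , ¬s) with j ≟ᶜ k
        ... | yes j≡k = j≡k
        ... | no j≢k  = contradiction (lose j∈ (j≢k , xj , yj)) ¬s

      owners-diagonal : ∀ {x} → x ∈ R → owners x x ≡ 0
      owners-diagonal x∈ = ∑𝟙-none (own? _ _) λ k∈ (xk , _ , ¬s) → ¬s (¬private⇒shared (np k∈) x∈ xk)

      ownPairs≤ : ∀ k → ownPairs R C k ≤ ∑ R λ x → ∑ R λ y → 𝟙 (own? x y k)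
      ownPairs≤ k = ≤-trans
        (∑-mono {g = λ x → ∑ (column R k) λ y → 𝟙 (own? x y k)} λ {x} x∈ →
          ∑-mono λ {y} y∈ → ≤-reflexive (𝟙-cong (¬? (shared? C k x y)) (own? x y k)
            (λ ¬s → proj₂ (∈-filter⁻ (λ i → M i k ≟ᵇ true) {xs = R} x∈) ,
                    proj₂ (∈-filter⁻ (λ i → M i k ≟ᵇ true) {xs = R} y∈) , ¬s)
            (proj₂ ∘ proj₂)))
        (≤-trans (∑-filter-≤ (λ i → M i k ≟ᵇ true) R _)
          (∑-mono {xs = R} λ _ → ∑-filter-≤ (λ i → M i k ≟ᵇ true) R _))

    -- Double counting: an ordered pair of rows has at most one owner, and a diagonal pair has none
    -- because no row is private. The diagonal accounts for the summand `length R`.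
    ∑ownPairs : ∑ C (ownPairs R C) + length R ≤ length R * length R
    ∑ownPairs = begin
      ∑ C (ownPairs R C) + length R
        ≤⟨ +-monoˡ-≤ _ (∑-mono {xs = C} (λ {k} _ → ownPairs≤ k)) ⟩
      ∑ C (λ k → ∑ R λ x → ∑ R λ y → 𝟙 (own? x y k)) + length R
        ≡⟨ cong (_+ length R) (∑-swap C R _) ⟩
      ∑ R (λ x → ∑ C λ k → ∑ R λ y → 𝟙 (own? x y k)) + length R
        ≤⟨ +-monoˡ-≤ _ (∑-mono {xs = R} (λ {x} _ → ≤-reflexive (∑-swap C R λ k y → 𝟙 (own? x y k)))) ⟩
      ∑ R (λ x → ∑ R (owners x)) + length R
        ≡⟨ +-comm _ (length R) ⟩
      length R + ∑ R (λ x → ∑ R (owners x))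
        ≡⟨ cong (_+ ∑ R (λ x → ∑ R (owners x))) (sym (trans (∑-const R 1) (*-identityʳ (length R)))) ⟩
      ∑ R (λ _ → 1) + ∑ R (λ x → ∑ R (owners x))
        ≡⟨ sym (∑-+ R _ _) ⟩
      ∑ R (λ x → suc (∑ R (owners x)))
        ≤⟨ ∑-mono (λ {x} x∈ → ∑-≤1-zero (owners≤1 x) x∈ (owners-diagonal x∈)) ⟩
      ∑ R (λ _ → length R)
        ≡⟨ ∑-const R (length R) ⟩
      length R * length R ∎
      where open ≤-Reasoning

  -- The deleted row meets no column but k, so it never serves as witness for a column of `C′`.
  coverFree-private : CoverFree t R C → R ↭ i ∷ R′ → C ↭ k ∷ C′ → k ∉ C′ →
    PrivateRow C k i → CoverFree t R′ C′
  coverFree-private cf pR pC k∉ (_ , only) S⊆ j∈ j∉S S≤t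
    with C′⊆ ← (λ {x} (x∈ : x ∈ _) → ∈-resp-↭ (↭-sym pC) (there x∈))
    with i′ , i′∈ , i′j , avoid ← cf (All.map C′⊆ S⊆) (C′⊆ j∈) j∉S S≤t
    with ∈-resp-↭ pR i′∈
  ... | here refl  = contradiction (subst (_∈ _) (All.lookup only (C′⊆ j∈) i′j) j∈) k∉
  ... | there i′∈′ = i′ , i′∈′ , i′j , avoid

  -- Adding k to `S` costs one unit of t and forces the witness row to lie outside k.
  coverFree-column : CoverFree (suc t) R C → C ↭ k ∷ C′ → k ∉ C′ → CoverFree t (outside R k) C′
  coverFree-column {k = k} cf pC k∉ S⊆ j∈ j∉S S≤t
    with C′⊆ ← (λ {x} (x∈ : x ∈ _) → ∈-resp-↭ (↭-sym pC) (there x∈))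
    with i , i∈ , ij , ik ∷ avoid ← cf (∈-resp-↭ (↭-sym pC) (here refl) ∷ All.map C′⊆ S⊆) (C′⊆ j∈)
           (λ { (here refl) → k∉ j∈ ; (there j∈S) → j∉S j∈S }) (s≤s S≤t) =
    i , ∈-filter⁺ (λ i → ¬? (M i k ≟ᵇ true)) i∈
      (λ p → contradiction (trans (sym ik) p) λ ()) , ij , avoid

  -- An inequality between the numbers of rows and columns stands in for the equality of the
  -- theorem, because deleting a column with all its rows can leave more columns than rows.
  SomePrivate : ℕ → Set
  SomePrivate t = ∀ {R C} → Unique R → Unique C → CoverFree t R C → length R ≤ suc (length C) →
    1 ≤ length C → Below (t * t) (length R) → Any (HasPrivate R C) C

  below-≤ : ∀ t {n n′} → 0 < t → n′ ≤ n → Below (t * t) n → Below (t * t) n′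
  below-≤ t 0<t n′≤n = below-scale 0<T 0<T (*-monoˡ-≤ (t * t) n′≤n)
    where
    0<T : 0 < t * t
    0<T = *-mono-< {0} {t} {0} {t} 0<t 0<t

  below⇒0< : ∀ t {n} → Below (t * t) n → 0 < t
  below⇒0< zero b = contradiction (below⇒< b) λ ()
  below⇒0< (suc t) _ = s≤s z≤n

  -- Peeling off private rows

  record Peeled (t : ℕ) (R : List Row) (C : List Col) : Set where
    field
      {row}     : Row
      {col}     : Col
      {R⁻}      : List Row
      {C⁻}      : List Col
      R↭        : R ↭ row ∷ R⁻
      C↭        : C ↭ col ∷ C⁻
      isPrivate : PrivateRow C col row
      col∉      : col ∉ C⁻
      uniqueR   : Unique R⁻
      uniqueC   : Unique C⁻
      coverFree : CoverFree t R⁻ C⁻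
      size      : length R⁻ ≤ suc (length C⁻)
      below     : Below (t * t) (length R⁻)

  peel : SomePrivate t → Unique R → Unique C → CoverFree t R C → length R ≤ suc (length C) →
    1 ≤ length C → Below (t * t) (length R) → Peeled t R C
  peel {t} some uR uC cf le 1≤ b
    with k , k∈ , priv ← find (some uR uC cf le 1≤ b)
    with i , i∈ , row ← find priv
    with R′ , pR ← ∈⇒↭ i∈ | C′ , pC ← ∈⇒↭ k∈ = record
    { R↭ = pR ; C↭ = pC ; isPrivate = row
    ; col∉ = proj₁ (Unique⇒∉ pC uC)
    ; uniqueR = proj₂ (Unique⇒∉ pR uR)
    ; uniqueC = proj₂ (Unique⇒∉ pC uC)
    ; coverFree = coverFree-private cf pR pC (proj₁ (Unique⇒∉ pC uC)) row
    ; size = s≤s⁻¹ (subst₂ (λ u v → u ≤ suc v) (↭-length pR) (↭-length pC) le)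
    ; below = below-≤ t (below⇒0< t b) (≤-trans (n≤1+n _) (≤-reflexive (sym (↭-length pR)))) b
    }

  -- Each step removes one row and one column and preserves the hypotheses. It can be repeated until
  -- the columns are used up, and every column has then taken a row of its own.
  peel-all : SomePrivate t → ∀ c → length C ≡ c → Unique R → Unique C → CoverFree t R C →
    length R ≤ suc (length C) → Below (t * t) (length R) → c ≤ length R
  peel-all some zero _ _ _ _ _ _ = z≤n
  peel-all some (suc c) l uR uC cf le b =
    ≤-trans (s≤s (peel-all some c (suc-injective (trans (sym (↭-length C↭)) l))
        uniqueR uniqueC coverFree size below))
      (≤-reflexive (sym (↭-length R↭)))
    where open Peeled (peel some uR uC cf le (≤-trans (s≤s z≤n) (≤-reflexive (sym l))) b)

  ∃∈ : 1 ≤ length C → ∃ (_∈ C)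
  ∃∈ {C = k ∷ _} _ = k , here refl

  -- After deletion of k and its v rows, r rows and c columns remain, and `peel-all` gives c ≤ r.
  -- With v + r ≤ c + 2 this leaves v ≤ 2, whereas a column without a private row has more than t +
  -- 2 rows.
  large-column-absurd : SomePrivate (suc t) → Unique R → Unique C → CoverFree (2 + t) R C →
    length R ≤ suc (length C) → Below ((2 + t) * (2 + t)) (length R) →
    k ∈ C → ¬ HasPrivate R C k → 2 * length R ≤ length (column R k) * (2 + t) → ⊥
  large-column-absurd {t} {R} {C} {k} some uR uC cf le b k∈ np big with C′ , pC ← ∈⇒↭ k∈ =
    <⇒≱ (≤-trans (s≤s (s≤s (s≤s z≤n))) (column-size cf k∈ np)) v≤2
    where
    open ≤-Reasoning
    v r c : ℕ
    v = length (column R k)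
    r = length (outside R k)
    c = length C′
    v+r≡ : v + r ≡ length R
    v+r≡ = length-filter-¬ (λ i → M i k ≟ᵇ true) R
    C≡ : length C ≡ suc c
    C≡ = ↭-length pC
    1≤v : 1 ≤ v
    1≤v = ≤-trans (s≤s z≤n) (column-size cf k∈ np)
    v+r≤ : v + r ≤ 2 + c
    v+r≤ = begin
      v + r            ≡⟨ v+r≡ ⟩
      length R         ≤⟨ le ⟩
      suc (length C)   ≡⟨ cong suc C≡ ⟩
      2 + c            ∎
    c≤r : c ≤ r
    c≤r = peel-all some c refl (Unique.filter⁺ (λ i → ¬? (M i k ≟ᵇ true)) uR)
      (proj₂ (Unique⇒∉ pC uC)) (coverFree-column cf pC (proj₁ (Unique⇒∉ pC uC)))
      (s≤s⁻¹ (≤-trans (+-monoˡ-≤ r 1≤v) v+r≤)) (below-step {v = v} v+r≡ big b)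
    v≤2 : v ≤ 2
    v≤2 = +-cancelʳ-≤ r v 2 (≤-trans v+r≤ (+-monoʳ-≤ 2 c≤r))

  small-columns-absurd : Unique R → Unique C → CoverFree t R C → length R ≤ suc (length C) →
    1 ≤ length C → Below (t * t) (length R) → (∀ {k} → k ∈ C → ¬ HasPrivate R C k) →
    (∀ {k} → k ∈ C → length (column R k) * t < 2 * length R) → ⊥
  small-columns-absurd {R} {C} {t} uR uC cf le 1≤ b np small with k , k∈ ← ∃∈ 1≤ =
    -- Here n ≥ 2, because a column without a private row has more than t ≥ 1 rows. Each column has
    -- at least n + 1 own pairs, and (n - 1)(n + 1) + n > n² from n = 2 on.
    <⇒≱ (square-gap (≤-trans (s≤s (below⇒0< t b)) (≤-trans (column-size cf k∈ (np k∈)) (length-filter _ R)))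
      le) (begin
      length C * suc (length R) + length R   ≡⟨ cong (_+ length R) (sym (∑-const C _)) ⟩
      ∑ C (λ _ → suc (length R)) + length R
        ≤⟨ +-monoˡ-≤ _ (∑-mono λ k∈ →
          ownPairs-large uR cf k∈ (np k∈) (below⇒0< t b) b (small k∈)) ⟩
      ∑ C (ownPairs R C) + length R          ≤⟨ ∑ownPairs uC np ⟩
      length R * length R                    ∎)
    where
    open ≤-Reasoning
    square-gap : ∀ {n c} → 2 ≤ n → n ≤ suc c → n * n < c * suc n + n
    square-gap {suc n} {c} (s≤s 1≤n) (s≤s n≤c) = begin-strict
      suc n * suc n              <⟨ m<m+n _ 1≤n ⟩
      suc n * suc n + n          ≡⟨ e n ⟩
      n * suc (suc n) + suc n    ≤⟨ +-monoˡ-≤ (suc n) (*-monoˡ-≤ (suc (suc n)) n≤c) ⟩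
      c * suc (suc n) + suc n    ∎
      where
      e : ∀ n → suc n * suc n + n ≡ n * suc (suc n) + suc n
      e = solve-∀

  somePrivate-suc : SomePrivate t → SomePrivate (suc t)
  somePrivate-suc {t} some {R} {C} uR uC cf le 1≤ b with any? (hasPrivate? R C) C
  ... | yes p = p
  -- For parameter 1 the bound leaves no rows at all, yet k would need more than one.
  somePrivate-suc {zero} some {R} uR uC cf le 1≤ b | no none with k , k∈ ← ∃∈ 1≤ =
    contradiction (≤-trans (column-size cf k∈ (λ p → none (lose k∈ p)))
      (≤-trans (length-filter _ R) (s≤s⁻¹ (below⇒< b)))) λ ()
  somePrivate-suc {suc t} some {R} {C} uR uC cf le 1≤ b | no none
    with any? (λ k → 2 * length R ≤? length (column R k) * (2 + t)) C
  ... | yes big with k , k∈ , 2n≤ ← find big =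
    ⊥-elim (large-column-absurd some uR uC cf le b k∈ (λ p → none (lose k∈ p)) 2n≤)
  ... | no ¬big = ⊥-elim (small-columns-absurd uR uC cf le 1≤ b (λ k∈ p → none (lose k∈ p))
    (λ k∈ → ≰⇒> (λ 2n≤ → ¬big (lose k∈ 2n≤))))

  somePrivate : ∀ t → SomePrivate t
  somePrivate zero _ _ _ _ _ b = contradiction (below⇒< b) λ ()
  somePrivate (suc t) = somePrivate-suc (somePrivate t)

  -- From one private row to a private row for every column

  module _ (2≤t : 2 ≤ t) (cf : CoverFree t R C) (le : length R ≤ suc (length C))
    (peeled : Peeled t R C) where

    open Peeled peeled

    -- After peeling, the private rows of the other columns leave k at most two rows.
    peeled-private : (∀ {k} → k ∈ C⁻ → HasPrivate R⁻ C⁻ k) → ∀ {k} → k ∈ C⁻ → HasPrivate R C k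
    peeled-private allPrivate⁻ {k} k∈ with hasPrivate? R C k
    ... | yes p = p
    ... | no ¬p with D , q ← ∈⇒↭ k∈ = contradiction lower (<⇒≱ (s≤s upper))
      where
      open ≤-Reasoning
      C⁻⊆C : ∀ {j} → j ∈ C⁻ → j ∈ C
      C⁻⊆C j∈ = ∈-resp-↭ (↭-sym C↭) (there j∈)
      D⊆C⁻ : ∀ {j} → j ∈ D → j ∈ C⁻
      D⊆C⁻ j∈ = ∈-resp-↭ (↭-sym q) (there j∈)
      k∉D : k ∉ D
      k∉D = proj₁ (Unique⇒∉ q uniqueC)
      -- Three kinds of rows are counted: those of k, those private within `C⁻` to a column of `D`,
      -- and those private to `col`. No row is counted twice, and there are at least 3, `length D`
      -- and 1 of them, one more than `length R` allows.
      a b c : Row → ℕ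
      a i = 𝟙 (M i k ≟ᵇ true)
      b i = ∑ D (λ j → 𝟙 (privateRow? C⁻ j i))
      c i = 𝟙 (privateRow? C col i)
      disjoint : ∀ i → a i + b i + c i ≤ 1
      disjoint i with privateRow? C col i | M i k ≟ᵇ true
      ... | yes (_ , only) | yes ik =
        contradiction (subst (_∈ C⁻) (All.lookup only (C⁻⊆C k∈) ik) k∈) col∉
      ... | yes (_ , only) | no _ = ≤-reflexive (cong (_+ 1) (∑𝟙-none (λ j → privateRow? C⁻ j i)
              λ j∈ (ij , _) → col∉ (subst (_∈ C⁻) (All.lookup only (C⁻⊆C (D⊆C⁻ j∈)) ij) (D⊆C⁻ j∈))))
      ... | no _ | yes ik = ≤-reflexive (cong (λ u → suc (u + 0)) (∑𝟙-none (λ j → privateRow? C⁻ j i)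
              λ j∈ (_ , only) → k∉D (subst (_∈ D) (sym (All.lookup only k∈ ik)) j∈)))
      ... | no _ | no _ = ≤-trans (≤-reflexive (+-identityʳ _)) (∑𝟙-unique (λ j → privateRow? C⁻ j i)
              (proj₂ (Unique⇒∉ q uniqueC))
              λ x∈ _ (ix , _) (_ , only) → All.lookup only (D⊆C⁻ x∈) ix)
      -- The 3 comes from `column-size`: k has more than t ≥ 2 rows.
      lower : 3 + length D + 1 ≤ length R
      lower = begin
        3 + length D + 1
          ≤⟨ +-mono-≤ (+-mono-≤ (≤-trans (s≤s 2≤t) (column-size cf (C⁻⊆C k∈) ¬p)) D≤) col≤ ⟩
        length (column R k) + ∑ R b + ∑ R c
          ≡⟨ cong (λ u → u + ∑ R b + ∑ R c) (length-filter-∑ (λ i → M i k ≟ᵇ true) R) ⟩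
        ∑ R a + ∑ R b + ∑ R c
          ≡⟨ cong (_+ ∑ R c) (sym (∑-+ R a b)) ⟩
        ∑ R (λ i → a i + b i) + ∑ R c
          ≡⟨ sym (∑-+ R (λ i → a i + b i) c) ⟩
        ∑ R (λ i → a i + b i + c i)
          ≤⟨ ∑-mono {xs = R} {g = λ _ → 1} (λ {i} _ → disjoint i) ⟩
        ∑ R (λ _ → 1)
          ≡⟨ trans (∑-const R 1) (*-identityʳ (length R)) ⟩
        length R ∎
        where
        D≤ : length D ≤ ∑ R b
        D≤ = begin
          length D                 ≡⟨ sym (trans (∑-const D 1) (*-identityʳ (length D))) ⟩
          ∑ D (λ _ → 1)            ≤⟨ ∑-mono {xs = D} (λ {j} j∈ → ∑𝟙-some (privateRow? C⁻ j)
                                        (Any-resp-↭ (↭-sym R↭) (there (allPrivate⁻ (D⊆C⁻ j∈))))) ⟩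
          ∑ D (λ j → ∑ R (λ i → 𝟙 (privateRow? C⁻ j i))) ≡⟨ ∑-swap D R _ ⟩
          ∑ R b ∎
        col≤ : 1 ≤ ∑ R c
        col≤ = ∑𝟙-some (privateRow? C col) (Any-resp-↭ (↭-sym R↭) (here isPrivate))
      upper : length R ≤ 2 + length D + 1
      upper = begin
        length R             ≤⟨ le ⟩
        suc (length C)       ≡⟨ cong suc (trans (↭-length C↭) (cong suc (↭-length q))) ⟩
        3 + length D         ≡⟨ +-comm 1 (2 + length D) ⟩
        2 + length D + 1     ∎

  -- A row private within `C⁻` may still meet the peeled column, so privacy does not lift row by
  -- row; `peeled-private` recovers some private row by counting.
  allPrivate : 2 ≤ t → ∀ c → length C ≡ c → Unique R → Unique C → CoverFree t R C →
    length R ≤ suc (length C) → Below (t * t) (length R) → ∀ {k} → k ∈ C → HasPrivate R C k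
  allPrivate {C = []} _ zero _ _ _ _ _ _ ()
  allPrivate {t} {C} {R} 2≤t (suc c) l uR uC cf le b {k} k∈ =
    go (peel (somePrivate t) uR uC cf le (≤-trans (s≤s z≤n) (≤-reflexive (sym l))) b)
    where
    go : Peeled t R C → HasPrivate R C k
    go peeled with ∈-resp-↭ (Peeled.C↭ peeled) k∈
    ... | here refl = lose (∈-resp-↭ (↭-sym R↭) (here refl)) isPrivate
      where open Peeled peeled
    ... | there k∈⁻ = peeled-private 2≤t cf le peeled
        (allPrivate 2≤t c (suc-injective (trans (sym (↭-length C↭)) l))
          uniqueR uniqueC coverFree size below) k∈⁻
      where open Peeled peeled

-- From matrices to families and back

∣p∪q∣≤∣p∣+∣q∣ : ∀ {n} (p q : Subset n) → ∣ p ∪ q ∣ ≤ ∣ p ∣ + ∣ q ∣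
∣p∪q∣≤∣p∣+∣q∣ [] [] = z≤n
∣p∪q∣≤∣p∣+∣q∣ (false ∷ p) (false ∷ q) = ∣p∪q∣≤∣p∣+∣q∣ p q
∣p∪q∣≤∣p∣+∣q∣ (false ∷ p) (true ∷ q) =
  ≤-trans (s≤s (∣p∪q∣≤∣p∣+∣q∣ p q)) (≤-reflexive (sym (+-suc ∣ p ∣ ∣ q ∣)))
∣p∪q∣≤∣p∣+∣q∣ (true ∷ p) (false ∷ q) = s≤s (∣p∪q∣≤∣p∣+∣q∣ p q)
∣p∪q∣≤∣p∣+∣q∣ (true ∷ p) (true ∷ q) = s≤s (≤-trans (∣p∪q∣≤∣p∣+∣q∣ p q) (+-monoʳ-≤ ∣ p ∣ (n≤1+n ∣ q ∣)))

fromList : ∀ {n} → List (Fin n) → Subset n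
fromList = foldr (λ x p → ⁅ x ⁆ ∪ p) ∅

∣fromList∣≤ : ∀ {n} (xs : List (Fin n)) → ∣ fromList xs ∣ ≤ length xs
∣fromList∣≤ {n} [] = ≤-reflexive (∣⊥∣≡0 n)
∣fromList∣≤ (x ∷ xs) = ≤-trans (∣p∪q∣≤∣p∣+∣q∣ ⁅ x ⁆ (fromList xs))
  (+-mono-≤ (≤-reflexive (∣⁅x⁆∣≡1 x)) (∣fromList∣≤ xs))

∈-fromList⁺ : ∀ {n} {x : Fin n} {xs} → x ∈ xs → x ∈ˢ fromList xs
∈-fromList⁺ {x = x} (here refl) = x∈p∪q⁺ (inj₁ (x∈⁅x⁆ x))
∈-fromList⁺ (there x∈) = x∈p∪q⁺ (inj₂ (∈-fromList⁺ x∈))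

∈-fromList⁻ : ∀ {n} {x : Fin n} xs → x ∈ˢ fromList xs → x ∈ xs
∈-fromList⁻ [] x∈ = contradiction x∈ ∉⊥
∈-fromList⁻ (y ∷ ys) x∈ with x∈p∪q⁻ ⁅ y ⁆ (fromList ys) x∈
... | inj₁ x∈y  = here (x∈⁅y⁆⇒x≡y y x∈y)
... | inj₂ x∈ys = there (∈-fromList⁻ ys x∈ys)

-- The disjunctness condition for the empty set of columns follows from that for a singleton.
disjunct⇒coverFree : ∀ {t r m} (M : BinMatrix r m) → 1 ≤ t → 2 ≤ m → Disjunct t M →
  CoverFreeFamily.CoverFree _≟_ _≟_ M t (allFin r) (allFin m)
disjunct⇒coverFree {t} {r} {m} M 1≤t 2≤m (_ , dis) {S} {k} _ _ = nonEmpty S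
  where
  other : ∀ {m} → 2 ≤ m → (k : Fin m) → ∃ λ j → j ≢ k
  other (s≤s (s≤s _)) zero = suc zero , λ ()
  other (s≤s (s≤s _)) (suc k) = zero , λ ()

  nonEmpty : ∀ S → k ∉ S → length S ≤ t →
    ∃ λ i → i ∈ allFin r × M i k ≡ true × All (λ j → M i j ≡ false) S
  nonEmpty S@(j ∷ S′) k∉S S≤t
    with i , ik , avoid ← dis (fromList S)
           (≤-trans (≤-reflexive (sym (∣⁅x⁆∣≡1 j))) (∣p∣≤∣p∪q∣ ⁅ j ⁆ (fromList S′)))
           (≤-trans (∣fromList∣≤ S) S≤t) k (k∉S ∘ ∈-fromList⁻ S) =
    i , ∈-allFin i , ik , All.tabulate (λ j∈ → avoid _ (∈-fromList⁺ j∈))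
  nonEmpty [] _ _ with j , j≢k ← other 2≤m k
    with i , i∈ , ik , _ ← nonEmpty (j ∷ []) (λ { (here k≡j) → j≢k (sym k≡j) }) 1≤t =
    i , i∈ , ik , []

-- The later values avoid `f zero`; punching it out leaves an injection of the same shape one size
-- down, and `insert` puts it back.
extend-injection : ∀ {m} (f : Fin m → Fin (suc m)) → Injective _≡_ _≡_ f →
  Σ (Permutation′ (suc m)) λ ρ → ∀ i → ρ ⟨$⟩ʳ inject₁ i ≡ f i
extend-injection {zero} f _ = Perm.id , λ ()
extend-injection {suc m} f inj with extend-injection g g-injective
  where
  f₀≢ : ∀ i → f zero ≢ f (suc i)
  f₀≢ i eq = contradiction (inj eq) λ ()
  g : Fin m → Fin (suc m)
  g i = punchOut (f₀≢ i)
  g-injective : Injective _≡_ _≡_ g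
  g-injective {x} {y} eq with refl ← inj (punchOut-injective (f₀≢ x) (f₀≢ y) eq) = refl
... | ρ , ρ≗g = insert zero (f zero) ρ , λ
  { zero → refl
  ; (suc i) → trans (insert-punchIn zero (f zero) ρ (inject₁ i))
      (trans (cong (punchIn (f zero)) (ρ≗g i)) (punchIn-punchOut _)) }

theorem6p1 : (t m : ℕ) → 1 ≤ t → 2 < suc m → BelowBound t (suc m) →
    (M : BinMatrix (suc m) m) → Disjunct t M →
    Σ (Permutation′ (suc m)) λ ρ →
    IsPermutationMatrix {m} (λ i j → M (ρ ⟨$⟩ʳ inject₁ i) j)
theorem6p1 t m 1≤t 2<n bound M disjunct = ρ , rows , columns
  where
  open CoverFreeFamily _≟_ _≟_ M

  |allFin| : ∀ n → length (allFin n) ≡ n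
  |allFin| n = length-tabulate id

  below : Below (t * t) (suc m)
  below = belowBound⇒below t (suc m) bound

  -- For t = 1 the bound would give n < 1.
  2≤t : ∀ {t} → 1 ≤ t → suc m < t * t → 2 ≤ t
  2≤t {suc zero} _ (s≤s ())
  2≤t {suc (suc t)} _ _ = s≤s (s≤s z≤n)

  hasPrivate : ∀ k → HasPrivate (allFin (suc m)) (allFin m) k
  hasPrivate k = allPrivate (2≤t 1≤t (below⇒< below)) m (|allFin| m)
    (Unique.allFin⁺ (suc m)) (Unique.allFin⁺ m) (disjunct⇒coverFree M 1≤t (s≤s⁻¹ 2<n) disjunct)
    (≤-reflexive (trans (|allFin| (suc m)) (cong suc (sym (|allFin| m)))))
    (subst (Below (t * t)) (sym (|allFin| (suc m))) below) (∈-allFin k)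

  row : Fin m → Fin (suc m)
  row k = proj₁ (find (hasPrivate k))

  row-true : ∀ k → M (row k) k ≡ true
  row-true k = proj₁ (proj₂ (proj₂ (find (hasPrivate k))))

  row-only : ∀ k {j} → M (row k) j ≡ true → j ≡ k
  row-only k {j} = All.lookup (proj₂ (proj₂ (proj₂ (find (hasPrivate k))))) (∈-allFin j)

  row-injective : Injective _≡_ _≡_ row
  row-injective {j} {k} eq = row-only k (trans (cong (λ i → M i j) (sym eq)) (row-true j))

  -- The private row of column i is moved to position i, so the first m rows form the identity
  -- matrix.
  ρ : Permutation′ (suc m)
  ρ = proj₁ (extend-injection row row-injective)

  ρ≗row : ∀ i → ρ ⟨$⟩ʳ inject₁ i ≡ row i
  ρ≗row = proj₂ (extend-injection row row-injective)

  entry : ∀ {i j b} → M (row i) j ≡ b → M (ρ ⟨$⟩ʳ inject₁ i) j ≡ b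
  entry {i} {j} = trans (cong (λ r → M r j) (ρ≗row i))

  entry⁻ : ∀ {i j b} → M (ρ ⟨$⟩ʳ inject₁ i) j ≡ b → M (row i) j ≡ b
  entry⁻ {i} {j} = trans (cong (λ r → M r j) (sym (ρ≗row i)))

  rows : ∀ i → ExactlyOneTrue (λ j → M (ρ ⟨$⟩ʳ inject₁ i) j)
  rows i = i , entry (row-true i) , λ j ij → row-only i (entry⁻ ij)

  columns : ∀ j → ExactlyOneTrue (λ i → M (ρ ⟨$⟩ʳ inject₁ i) j)
  columns j = j , entry (row-true j) , λ i ij → sym (row-only i (entry⁻ ij))
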